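{- Let $n\ge 2$ and let $f$ be a self-dual Hecke--Maass form for $SL(n,\mathbb{Z})$, normalized by $A(1,\dots,1)=1$, with Satake parameters $\alpha_{p,i}$ ($p$ prime, $1\le i\le n$), and let $a_f(p^r)=\sum_{i=1}^n\alpha_{p,i}^r$. Suppose that Ramanujan's generalized weak conjecture holds for $f$, i.e. there is some (small) $\epsilon_1>0$ such that $$|\alpha_{p,i}|\le p^{\frac14-\epsilon_1}\qquad\text{for every prime } p \text{ and every } i=1,\dots,n.$$ Then the Rudnick--Sarnak conjecture holds for $f$, i.e. for every fixed integer $r\ge 2$, $$\sum_p\frac{|a_f(p^r)|^2(\log p)^2}{p^r}<\infty,$$ where the sum is over all primes $p$.
   Context: **Hecke--Maass forms.** Let $n\ge2$ and $\mathcal{H}^n=GL(n,\mathbb{R})/(O(n,\mathbb{R})\cdot\mathbb{R}^\times)$ be the generalized upper half plane, with coordinates $z=xy$, $x$ upper triangular unipotent, $y=\mathrm{diag}(y_1\cdots y_{n-1},\dots,y_1,1)$, $y_i>0$. For $v=(v_1,\dots,v_{n-1})\in\mathbb{C}^{n-1}$ put $I_v(z)=\prod_{i,j=1}^{n-1}y_i^{b_{ij}v_j}$, where $b_{ij}=ij$ if $i+j\le n$ and $b_{ij}=(n-i)(n-j)$ if $i+j\ge n$. A Maass form of type $v$ for $SL(n,\mathbb{Z})$ is a smooth $f\in\mathcal{L}^2(SL(n,\mathbb{Z})\backslash\mathcal{H}^n)$ such that: (1) $f(\gamma z)=f(z)$ for all $\gamma\in SL(n,\mathbb{Z})$; (2)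 $Df=\lambda_Df$ for all $D$ in the center of the universal enveloping algebra of $\mathfrak{gl}(n,\mathbb{R})$, with $\lambda_D$ the eigenvalue of $D$ on $I_v$; (3) $\int_{(SL(n,\mathbb{Z})\cap U)\backslash U}f(uz)\,du=0$ for every group $U$ of block upper triangular matrices with diagonal blocks $I_{r_1},\dots,I_{r_b}$, $r_1+\dots+r_b=n$ (nontrivial $U$). A Hecke--Maass form is a Maass form that is an eigenfunction of all Hecke operators. **Fourier coefficients.** $f$ has the expansion $$f(z)=\sum_{\gamma\in U_{n-1}(\mathbb{Z})\backslash SL(n-1,\mathbb{Z})}\ \sum_{m_1,\dots,m_{n-2}\ge1}\ \sum_{m_{n-1}\ne0}\frac{A(m_1,\dots,m_{n-1})}{\prod_{j=1}^{n-1}|m_j|^{j(n-j)/2}}\,W_J\!\left(M\begin{pmatrix}\gamma&\\&1\end{pmatrix}z,\,v,\,\psi_{1,\dots,1,m_{n-1}/|m_{n-1}|}\right),$$ with $M=\mathrm{diag}(m_1\cdots m_{n-2}|m_{n-1}|,\dots,m_1m_2,m_1,1)$, $U_{k}$ the group of upper triangular unipotent $k\times k$ matrices, $\psi_{1,\dots,1,\epsilon}(u)=e^{2\pi i(u_1+\cdots+u_{n-2}+\epsilon u_{n-1})}$ where $u_{n-1},\dots,u_1$ are the superdiagonal entries of $u$ from top to bottom, and $W_J(z,v,\psi)=\int_{U_n(\mathbb{R})}I_v(wuz)\overline{\psi(u)}\,du$ (analytically continued) the Jacquet Whittaker function; here $w$ is the antidiagonal matrix with entries $1$ except for the top-right entry,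 which is $(-1)^{[n/2]}$. The normalization is $A(1,\dots,1)=1$. **Self-duality.** The dual form is $\tilde f(z)=f(w\,(z^{ -1})^T w)$; its coefficients are $A(m_{n-1},\dots,m_1)=\overline{A(m_1,\dots,m_{n-1})}$. $f$ is self-dual if $\tilde f=f$. **Satake parameters.** For each prime $p$, $\alpha_{p,1},\dots,\alpha_{p,n}$ are the complex roots of $$X^n+\sum_{j=1}^{n-1}(-1)^jA(1,\dots,1,p,1,\dots,1)X^{n-j}+(-1)^n,$$ with $p$ in the $j$-th position in the $j$-th term. -}

module Defs where

open import Algebra.Bundles using (RawSemiring)
import Algebra.Definitions.RawSemiring as SemiringDefs
open import Algebra.Structures using (IsCommutativeRing)
open import Axiom.ExcludedMiddle using (ExcludedMiddle)
open import Data.Bool.Base using (Bool; true; false; if_then_else_; T; _∧_)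
open import Data.Fin.Base using (Fin; zero; suc; toℕ; inject₁; punchIn; opposite)
open import Data.Fin.Properties using () renaming (_≟_ to _≟ᶠ_)
open import Data.Fin.Relation.Unary.Top using (view; ‵fromℕ; ‵inject₁)
open import Data.Integer.Base as ℤ using (ℤ; +_; -[1+_]; ∣_∣; _◃_)
open import Data.List.Base as List using (List; []; _∷_; _++_; allFin; concatMap; foldr)
open import Data.List.Relation.Binary.Subset.Propositional using (_⊆_)
open import Data.List.Relation.Unary.All using (All)
open import Data.List.Relation.Unary.AllPairs using (AllPairs)
open import Data.List.Relation.Unary.Any using (Any)
open import Data.List.Relation.Unary.Unique.Propositional using (Unique)
open import Data.Nat.Base as ℕ using (ℕ; zero; suc; _∸_; _<ᵇ_; _≤ᵇ_; ⌊_/2⌋; _!)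
open import Data.Nat.ListAction using () renaming (sum to sumℕ)
open import Data.Nat.Primality using (Prime; prime?)
open import Data.Product.Base using (Σ; Σ-syntax; ∃; ∃-syntax; _×_; _,_)
open import Data.Sign.Base as Sign using (Sign)
open import Data.Sum.Base using (_⊎_; inj₁; inj₂)
open import Data.Vec.Base as Vec using (Vec; lookup; replicate; _[_]≔_; _∷ʳ_)
open import Function.Base using (_∘_)
open import Level using (0ℓ)
open import Relation.Binary.PropositionalEquality.Core using (_≡_; _≢_; _≗_)
open import Relation.Binary.Structures using (IsStrictTotalOrder)
open import Relation.Nullary.Decidable.Core using (Dec; yes; no; does; T?)
open import Relation.Nullary.Negation.Core using (¬_)

------------------------------------------------------------------------
-- The real numbers

-- A Dedekind-complete ordered field; it is unique up to isomorphism.  As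
-- usual _⁻¹ is total and its value at 0 is unspecified.
record CompleteOrderedField : Set₁ where
  infix  4 _<_ _≤_
  infixl 6 _+_
  infixl 7 _*_
  infix  8 -_
  infix  9 _⁻¹
  field
    ℝ                  : Set
    _+_ _*_            : ℝ → ℝ → ℝ
    -_ _⁻¹             : ℝ → ℝ
    0# 1#              : ℝ
    _<_                : ℝ → ℝ → Set
    isCommutativeRing  : IsCommutativeRing _≡_ _+_ _*_ -_ 0# 1#
    0≢1                : 0# ≢ 1#
    *-inverse          : ∀ x → x ≢ 0# → x * x ⁻¹ ≡ 1#
    isStrictTotalOrder : IsStrictTotalOrder _≡_ _<_
    +-mono-<           : ∀ x y z → x < y → x + z < y + z
    *-pos              : ∀ x y → 0# < x → 0# < y → 0# < x * y

  _≤_ : ℝ → ℝ → Set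
  x ≤ y = x < y ⊎ x ≡ y

  UpperBound : (ℝ → Set) → ℝ → Set
  UpperBound P b = ∀ x → P x → x ≤ b

  field
    supremum : (P : ℝ → Set) → ∃ P → ∃ (UpperBound P) →
               ∃[ s ] UpperBound P s × (∀ b → UpperBound P b → s ≤ b)

------------------------------------------------------------------------
-- Square matrices

module Matrix (S : RawSemiring 0ℓ 0ℓ) where

  open RawSemiring S
  open SemiringDefs S using (sum)

  Mat : ℕ → Set
  Mat n = Fin n → Fin n → Carrier

  infix 4 _≐_
  _≐_ : ∀ {n} → Mat n → Mat n → Set
  M ≐ N = ∀ i j → M i j ≡ N i j

  infixl 7 _·_
  _·_ : ∀ {n} → Mat n → Mat n → Mat n
  (M · N) i j = sum (λ l → M i l * N l j)

  diag : ∀ {n} → (Fin n → Carrier) → Mat n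
  diag d i j = if does (i ≟ᶠ j) then d i else 0#

  I : ∀ {n} → Mat n
  I = diag (λ _ → 1#)

  infix 9 _ᵀ
  _ᵀ : ∀ {n} → Mat n → Mat n
  (M ᵀ) i j = M j i

module Mℤ = Matrix ℤ.+-*-rawSemiring

det : ∀ {n} → Mℤ.Mat n → ℤ
det {zero}  _ = + 1
det {suc n} M = sum λ j →
  -[1+ 0 ] ℤ.^ toℕ j ℤ.* M zero j ℤ.* det (λ i l → M (suc i) (punchIn j l))
  where
  open SemiringDefs ℤ.+-*-rawSemiring using (sum)

SLℤ : ∀ {n} → Mℤ.Mat n → Set
SLℤ γ = det γ ≡ + 1

-- U_n(ℤ)
Unipotentℤ : ∀ {n} → Mℤ.Mat n → Set
Unipotentℤ u = (∀ i → u i i ≡ + 1) × (∀ i j → toℕ j ℕ.< toℕ i → u i j ≡ + 0)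

-- γ ↦ (γ 0; 0 1)
corner : ∀ {m} → Mℤ.Mat m → Mℤ.Mat (suc m)
corner γ i j with view i | view j
... | ‵inject₁ i′ | ‵inject₁ j′ = γ i′ j′
... | ‵fromℕ      | ‵fromℕ      = + 1
... | _           | _           = + 0

-- A type of representatives for U_m(ℤ)\SL(m,ℤ), one for each coset.
record Transversal (m : ℕ) : Set₁ where
  field
    Index    : Set
    rep      : Index → Mℤ.Mat m
    rep∈SL   : ∀ i → SLℤ (rep i)
    covers   : ∀ γ → SLℤ γ →
               ∃[ i ] ∃[ u ] Unipotentℤ u × γ Mℤ.≐ u Mℤ.· rep i
    disjoint : ∀ i j u → Unipotentℤ u → rep i Mℤ.≐ u Mℤ.· rep j → i ≡ j

-- α ∈ Γ g Γ and α ∈ Γ β, for Γ = SL(n,ℤ).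
InDoubleCoset SameCoset : ∀ {n} → Mℤ.Mat n → Mℤ.Mat n → Set
InDoubleCoset g α =
  ∃[ γ ] ∃[ γ′ ] SLℤ γ × SLℤ γ′ × α Mℤ.≐ γ Mℤ.· g Mℤ.· γ′
SameCoset α β = ∃[ γ ] SLℤ γ × α Mℤ.≐ γ Mℤ.· β

-- αs lists exactly one element of each coset in Γ\ΓgΓ.
record HeckeRepresentatives {n} (g : Mℤ.Mat n) (αs : List (Mℤ.Mat n)) : Set where
  field
    sound    : All (InDoubleCoset g) αs
    covers   : ∀ β → InDoubleCoset g β → Any (SameCoset β) αs
    disjoint : AllPairs (λ α β → ¬ SameCoset α β) αs

-- The position of the block containing the (0-based) index i when the
-- indices are cut into consecutive blocks of the given sizes.
blockOf : List ℕ → ℕ → ℕ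
blockOf []       i = 0
blockOf (r ∷ rs) i = if i <ᵇ r then 0 else suc (blockOf rs (i ∸ r))

-- The positions (i , j) with i in an earlier block than j.
Above : ∀ {n} → (Fin n → ℕ) → Set
Above {n} b = Σ[ i ∈ Fin n ] Σ[ j ∈ Fin n ] T (b i <ᵇ b j)

allAbove : ∀ {n} (b : Fin n → ℕ) → List (Above b)
allAbove {n} b = concatMap (λ i → concatMap (λ j → at i j) (allFin n)) (allFin n)
  where
  at : ∀ i j → List (Above b)
  at i j with T? (b i <ᵇ b j)
  ... | yes p = (i , j , p) ∷ []
  ... | no  _ = []

------------------------------------------------------------------------

module Theory (em : ExcludedMiddle 0ℓ) (ℛ : CompleteOrderedField) where

  open CompleteOrderedField ℛ public
  open IsStrictTotalOrder isStrictTotalOrder public using (_<?_)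

  infixl 6 _-_
  _-_ : ℝ → ℝ → ℝ
  x - y = x + - y

  ℝ-rawSemiring : RawSemiring 0ℓ 0ℓ
  ℝ-rawSemiring = record
    { Carrier = ℝ ; _≈_ = _≡_ ; _+_ = _+_ ; _*_ = _*_ ; 0# = 0# ; 1# = 1# }

  open SemiringDefs ℝ-rawSemiring public using (sum; product; _^_)
  open Matrix ℝ-rawSemiring public

  fromℕ : ℕ → ℝ
  fromℕ zero    = 0#
  fromℕ (suc n) = 1# + fromℕ n

  fromℤ : ℤ → ℝ
  fromℤ (+ n)    = fromℕ n
  fromℤ -[1+ n ] = - fromℕ (suc n)

  fromSign : Sign → ℝ
  fromSign s = fromℤ (s ◃ 1)

  abs : ℝ → ℝ
  abs x = if does (x <? 0#) then - x else x

  -- Some element satisfying P if there is one, and the default d if not.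
  -- It is only applied to predicates with at most one solution.
  the : {X : Set} → X → (X → Set) → X
  the d P with em {∃ P}
  ... | yes (x , _) = x
  ... | no  _       = d

  sqrt : ℝ → ℝ
  sqrt x = the 0# λ y → 0# ≤ y × y * y ≡ x

  -- The series Σ_{k ≥ 0} a k converges with sum L.
  SumsTo : (ℕ → ℝ) → ℝ → Set
  SumsTo a L = ∀ ε → 0# < ε → ∃[ N ] ∀ m → N ℕ.≤ m →
    abs (sum {m} (a ∘ toℕ) - L) < ε

  Summable : (ℕ → ℝ) → Set
  Summable a = ∃ (SumsTo a)

  exp : ℝ → ℝ
  exp x = the 0# (SumsTo λ k → x ^ k * fromℕ (k !) ⁻¹)

  log : ℝ → ℝ
  log x = the 0# λ y → exp y ≡ x

  -- real powers of positive numbers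
  infixr 8 _^ʳ_
  _^ʳ_ : ℝ → ℝ → ℝ
  x ^ʳ s = exp (s * log x)

  -- Leibniz's series
  π : ℝ
  π = the 0# (SumsTo λ k →
        fromℕ 4 * (- 1#) ^ k * fromℕ (suc (2 ℕ.* k)) ⁻¹)

  ----------------------------------------------------------------------
  -- Complex numbers

  record ℂ : Set where
    constructor _+i_
    field
      re im : ℝ
  open ℂ public

  infixl 6 _+ᶜ_ _-ᶜ_
  infixl 7 _*ᶜ_ _•_

  _+ᶜ_ _-ᶜ_ _*ᶜ_ : ℂ → ℂ → ℂ
  z +ᶜ w = (re z + re w) +i (im z + im w)
  z -ᶜ w = (re z - re w) +i (im z - im w)
  z *ᶜ w = (re z * re w - im z * im w) +i (re z * im w + im z * re w)

  _•_ : ℝ → ℂ → ℂ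
  r • z = (r * re z) +i (r * im z)

  ofℝ : ℝ → ℂ
  ofℝ r = r +i 0#

  0ᶜ 1ᶜ : ℂ
  0ᶜ = ofℝ 0#
  1ᶜ = ofℝ 1#

  conj : ℂ → ℂ
  conj z = re z +i (- im z)

  ∥_∥ : ℂ → ℝ
  ∥ z ∥ = sqrt (re z * re z + im z * im z)

  ℂ-rawSemiring : RawSemiring 0ℓ 0ℓ
  ℂ-rawSemiring = record
    { Carrier = ℂ ; _≈_ = _≡_ ; _+_ = _+ᶜ_ ; _*_ = _*ᶜ_ ; 0# = 0ᶜ ; 1# = 1ᶜ }

  open SemiringDefs ℂ-rawSemiring public
    renaming (sum to sumᶜ; product to productᶜ; _^_ to _^ᶜ_)
    using ()

  SumsToᶜ : (ℕ → ℂ) → ℂ → Set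
  SumsToᶜ a L = ∀ ε → 0# < ε → ∃[ N ] ∀ m → N ℕ.≤ m →
    ∥ sumᶜ {m} (a ∘ toℕ) -ᶜ L ∥ < ε

  expᶜ : ℂ → ℂ
  expᶜ z = the 0ᶜ (SumsToᶜ λ k → fromℕ (k !) ⁻¹ • z ^ᶜ k)

  -- complex powers of positive numbers
  infixr 8 _^ˢ_
  _^ˢ_ : ℝ → ℂ → ℂ
  y ^ˢ s = expᶜ (log y • s)

  -- e(x) = exp(2πix)
  e : ℝ → ℂ
  e x = expᶜ (0# +i (fromℕ 2 * π * x))

  -- Unordered summation: the finite partial sums converge to L along the
  -- directed set of finite subsets of X.
  HasSum : {X : Set} → (X → ℂ) → ℂ → Set
  HasSum {X} a L = ∀ ε → 0# < ε → ∃[ S₀ ] Unique S₀ × (∀ S → Unique S → S₀ ⊆ S →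
    ∥ foldr (λ x s → a x +ᶜ s) 0ᶜ S -ᶜ L ∥ < ε)

  -- Holomorphic on all of ℂ^d, i.e. complex (Fréchet) differentiable at
  -- every point.
  Entire : ∀ {d} → ((Fin d → ℂ) → ℂ) → Set
  Entire {d} F = ∀ v → Σ[ D ∈ (Fin d → ℂ) ] ∀ ε → 0# < ε → ∃[ δ ] 0# < δ × (∀ v′ →
    dist v v′ < δ →
    ∥ F v′ -ᶜ F v -ᶜ sumᶜ (λ j → D j *ᶜ (v′ j -ᶜ v j)) ∥ ≤ ε * dist v v′)
    where
    dist : (v v′ : Fin d → ℂ) → ℝ
    dist v v′ = sum λ j → ∥ v′ j -ᶜ v j ∥

  -- φ is differentiable at 0 with φ′(0) = L.
  HasDerivativeAt0 : (ℝ → ℂ) → ℂ → Set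
  HasDerivativeAt0 φ L = ∀ ε → 0# < ε → ∃[ δ ] 0# < δ × (∀ t → abs t < δ →
    ∥ φ t -ᶜ φ 0# -ᶜ t • L ∥ ≤ ε * abs t)

  ----------------------------------------------------------------------
  -- The Lebesgue integral on ℝ^X, for X a finite type enumerated without
  -- repetition by a list

  module Lebesgue {X : Set} (enum : List X) where

    -- ∏ [lo i , hi i)
    record Brick : Set where
      field lo hi : X → ℝ
    open Brick

    ∏ : (X → ℝ) → ℝ
    ∏ a = foldr (λ i s → a i * s) 1# enum

    volume : Brick → ℝ
    volume B = ∏ λ i → if does (lo B i <? hi B i) then hi B i - lo B i else 0#

    indicator : Brick → (X → ℝ) → ℝ
    indicator B x = ∏ λ i →
      if does (x i <? lo B i) then 0# else
      if does (x i <? hi B i) then 1# else 0#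

    -- Mikusiński's definition: g is integrable with integral L iff there are
    -- c k ∈ ℂ and bricks B k with Σ |c k| vol(B k) < ∞ such that
    -- g(x) = Σ c k 1_{B k}(x) at every x where this series converges
    -- absolutely, and then L = Σ c k vol(B k).
    HasIntegral : ((X → ℝ) → ℂ) → ℂ → Set
    HasIntegral g L =
      Σ[ c ∈ (ℕ → ℂ) ] Σ[ B ∈ (ℕ → Brick) ]
        Summable (λ k → ∥ c k ∥ * volume (B k))
      × (∀ x → Summable (λ k → ∥ c k ∥ * indicator (B k) x) →
               SumsToᶜ (λ k → indicator (B k) x • c k) (g x))
      × SumsToᶜ (λ k → volume (B k) • c k) L

    Integrable : ((X → ℝ) → ℂ) → Set
    Integrable g = ∃ (HasIntegral g)

    unitCube : Brick
    unitCube = record { lo = λ _ → 0# ; hi = λ _ → 1# }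

  ----------------------------------------------------------------------
  -- Matrix groups

  embed : ∀ {n} → Mℤ.Mat n → Mat n
  embed γ i j = fromℤ (γ i j)

  Inverse : ∀ {n} → Mat n → Mat n → Set
  Inverse g h = g · h ≐ I × h · g ≐ I

  GL : ∀ {n} → Mat n → Set
  GL g = ∃ (Inverse g)

  Orthogonal : ∀ {n} → Mat n → Set
  Orthogonal k = Inverse k (k ᵀ)

  infixr 7 _•ₘ_
  _•ₘ_ : ∀ {n} → ℝ → Mat n → Mat n
  (t •ₘ g) i j = t * g i j

  infixl 6 _+ₘ_
  _+ₘ_ : ∀ {n} → Mat n → Mat n → Mat n
  (g +ₘ h) i j = g i j + h i j

  -- Equality of classes in GL(n,ℝ)/(O(n,ℝ)·ℝ^×).
  infix 4 _≈ᴴ_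
  _≈ᴴ_ : ∀ {n} → Mat n → Mat n → Set
  g ≈ᴴ h = ∃[ k ] ∃[ t ] Orthogonal k × t ≢ 0# × h ≐ t •ₘ (g · k)

  -- The matrix with identity diagonal blocks and the given entries above them.
  unipotent : ∀ {n} (b : Fin n → ℕ) → (Above b → ℝ) → Mat n
  unipotent b x i j with T? (b i <ᵇ b j)
  ... | yes p = x (i , j , p)
  ... | no  _ = I i j

  -- The antidiagonal matrix with top-right entry (-1)^[n/2] and all other
  -- antidiagonal entries 1.
  w : ∀ {n} → Mat n
  w {n} zero    j = if does (opposite j ≟ᶠ zero) then (- 1#) ^ ⌊ n /2⌋ else 0#
  w     (suc i) j = if does (opposite j ≟ᶠ suc i) then 1# else 0#

  ----------------------------------------------------------------------
  -- Functions on GL(n,ℝ), as total functions on matrices whose values at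
  -- singular matrices are never used

  module _ {n : ℕ} where

    ContinuousOnGL : (Mat n → ℂ) → Set
    ContinuousOnGL f = ∀ g → GL g → ∀ ε → 0# < ε → ∃[ δ ] 0# < δ × (∀ h → GL h →
      (∀ i j → abs (h i j - g i j) < δ) → ∥ f h -ᶜ f g ∥ < ε)

    E : Fin n → Fin n → Mat n
    E i j k l = if does (i ≟ᶠ k) ∧ does (j ≟ᶠ l) then 1# else 0#

    C : ℕ → (Mat n → ℂ) → Set
    C zero    f = ContinuousOnGL f
    C (suc r) f = ContinuousOnGL f × (∀ i j → ∃[ h ] C r h ×
      (∀ g → GL g → HasDerivativeAt0 (λ t → f (g +ₘ t •ₘ E i j)) (h g)))

    Smooth : (Mat n → ℂ) → Set
    Smooth f = ∀ r → C r f

    -- The universal enveloping algebra of gl(n,ℝ): terms, and the least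
    -- congruence for which they form an associative unital ℝ-algebra
    -- receiving gl(n,ℝ) linearly with [X,Y] = XY - YX.

    infixl 6 _⊕_
    infixl 7 _⊗_
    data 𝒰 : Set where
      gen     : Mat n → 𝒰
      scalar  : ℝ → 𝒰
      _⊕_ _⊗_ : 𝒰 → 𝒰 → 𝒰

    infix 4 _∼_
    data _∼_ : 𝒰 → 𝒰 → Set where
      ∼-refl      : ∀ {A} → A ∼ A
      ∼-sym       : ∀ {A B} → A ∼ B → B ∼ A
      ∼-trans     : ∀ {A B D} → A ∼ B → B ∼ D → A ∼ D
      ⊕-cong      : ∀ {A A′ B B′} → A ∼ A′ → B ∼ B′ → A ⊕ B ∼ A′ ⊕ B′
      ⊗-cong      : ∀ {A A′ B B′} → A ∼ A′ → B ∼ B′ → A ⊗ B ∼ A′ ⊗ B′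
      ⊕-assoc     : ∀ A B D → (A ⊕ B) ⊕ D ∼ A ⊕ (B ⊕ D)
      ⊕-comm      : ∀ A B → A ⊕ B ∼ B ⊕ A
      ⊕-identity  : ∀ A → scalar 0# ⊕ A ∼ A
      ⊗-assoc     : ∀ A B D → (A ⊗ B) ⊗ D ∼ A ⊗ (B ⊗ D)
      ⊗-identity  : ∀ A → scalar 1# ⊗ A ∼ A
      ⊗-zero      : ∀ A → scalar 0# ⊗ A ∼ scalar 0#
      distribˡ    : ∀ A B D → A ⊗ (B ⊕ D) ∼ (A ⊗ B) ⊕ (A ⊗ D)
      distribʳ    : ∀ A B D → (B ⊕ D) ⊗ A ∼ (B ⊗ A) ⊕ (D ⊗ A)
      scalar-+    : ∀ r s → scalar (r + s) ∼ scalar r ⊕ scalar s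
      scalar-*    : ∀ r s → scalar (r * s) ∼ scalar r ⊗ scalar s
      scalar-comm : ∀ r A → scalar r ⊗ A ∼ A ⊗ scalar r
      gen-cong    : ∀ {X Y} → X ≐ Y → gen X ∼ gen Y
      gen-+       : ∀ X Y → gen (X +ₘ Y) ∼ gen X ⊕ gen Y
      gen-•       : ∀ r X → gen (r •ₘ X) ∼ scalar r ⊗ gen X
      gen-bracket : ∀ X Y → gen ((X · Y) +ₘ (- 1#) •ₘ (Y · X)) ⊕ (gen Y ⊗ gen X)
                          ∼ gen X ⊗ gen Y

    Central : 𝒰 → Set
    Central D = ∀ A → D ⊗ A ∼ A ⊗ D

    -- D f = h on GL(n,ℝ), where X ∈ gl(n,ℝ) acts by
    -- (Xf)(g) = d/dt f(g exp(tX)) at t = 0, which is also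
    -- d/dt f(g + t gX) at t = 0.
    Acts : 𝒰 → (Mat n → ℂ) → (Mat n → ℂ) → Set
    Acts (gen X)    f h = ∀ g → GL g →
      HasDerivativeAt0 (λ t → f (g +ₘ t •ₘ (g · X))) (h g)
    Acts (scalar r) f h = ∀ g → GL g → h g ≡ r • f g
    Acts (A ⊕ B)    f h = ∃[ h₁ ] ∃[ h₂ ] Acts A f h₁ × Acts B f h₂ ×
      (∀ g → GL g → h g ≡ h₁ g +ᶜ h₂ g)
    Acts (A ⊗ B)    f h = ∃[ h₁ ] Acts B f h₁ × Acts A h₁ h

  ----------------------------------------------------------------------
  -- Hecke–Maass forms for SL(n,ℤ), n = k + 2

  module _ (k : ℕ) where

    private
      n = 2 ℕ.+ k
      n-1 = suc k

    -- Parameters v_j, y_j, m_j are numbered from 1 in formulas; the index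
    -- in Fin n-1 starts at 0.
    pos : Fin n-1 → ℕ
    pos j = suc (toℕ j)

    Coordinates : Set
    Coordinates = Above {n} toℕ ⊎ Fin n-1

    coordinates : List Coordinates
    coordinates = List.map inj₁ (allAbove toℕ) ++ List.map inj₂ (allFin n-1)

    -- diag(y_1⋯y_{n-1}, …, y_1, 1)
    yMatrix : (Fin n-1 → ℝ) → Mat n
    yMatrix y = diag λ i →
      product λ j → if toℕ i ℕ.+ toℕ j <ᵇ n-1 then y j else 1#

    -- z = xy
    point : (Coordinates → ℝ) → Mat n
    point c = unipotent toℕ (c ∘ inj₁) · yMatrix (c ∘ inj₂)

    Upper : (Coordinates → ℝ) → Set
    Upper c = ∀ j → 0# < c (inj₂ j)

    -- Density of the GL(n,ℝ)-invariant measure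
    -- ∏_{i<j} dx_{ij} ∏_j y_j^{-j(n-j)-1} dy_j.
    density : (Coordinates → ℝ) → ℝ
    density c = product λ j →
      (c (inj₂ j) ^ suc (pos j ℕ.* (n ∸ pos j))) ⁻¹

    b : ℕ → ℕ → ℕ
    b i j = if i ℕ.+ j ≤ᵇ n then i ℕ.* j else (n ∸ i) ℕ.* (n ∸ j)

    -- The coordinates of a class in the upper half plane are unique, so
    -- the choice made by em is immaterial.
    Iᵥ : (Fin n-1 → ℂ) → Mat n → ℂ
    Iᵥ v g with em {∃[ c ] Upper c × point c ≈ᴴ g}
    ... | yes (c , _) = productᶜ λ i → productᶜ λ j →
            c (inj₂ i) ^ˢ (fromℕ (b (pos i) (pos j)) • v j)
    ... | no  _       = 0ᶜ

    SameOrbit : (c c′ : Coordinates → ℝ) → Set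
    SameOrbit c c′ = ∃[ γ ] SLℤ γ × embed γ · point c ≈ᴴ point c′

    record FundamentalDomain (F : (Coordinates → ℝ) → Bool) : Set where
      field
        upper    : ∀ c → F c ≡ true → Upper c
        resp     : ∀ c c′ → c ≗ c′ → F c ≡ F c′
        covers   : ∀ c → Upper c → ∃[ c′ ] F c′ ≡ true × SameOrbit c c′
        disjoint : ∀ c c′ → F c ≡ true → F c′ ≡ true → SameOrbit c c′ → c ≗ c′

    open Lebesgue

    -- Square integrability on SL(n,ℤ)\ℋⁿ; measurability of F where f ≠ 0
    -- is part of the integrability of the restricted function.
    SquareIntegrable : (Mat n → ℂ) → Set
    SquareIntegrable f = ∃[ F ] FundamentalDomain F ×
      Integrable coordinates λ c →
        if F c then ofℝ (∥ f (point c) ∥ ^ 2 * density c) else 0ᶜ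

    -- The cube [0,1)^d represents (SL(n,ℤ)∩U)\U for the group U with
    -- diagonal blocks of sizes rs.
    Cuspidal : (Mat n → ℂ) → Set
    Cuspidal f = ∀ rs → All (1 ℕ.≤_) rs → sumℕ rs ≡ n → 2 ℕ.≤ List.length rs →
      let blk = λ (i : Fin n) → blockOf rs (toℕ i)
          U   = allAbove blk in
      ∀ z → GL z → HasIntegral U
        (λ x → indicator U (unitCube U) x • f (unipotent blk x · z)) 0ᶜ

    record MaassForm (v : Fin n-1 → ℂ) (f : Mat n → ℂ) : Set where
      field
        onℋ              : ∀ g h → GL g → g ≈ᴴ h → f g ≡ f h
        smooth           : Smooth f
        squareIntegrable : SquareIntegrable f
        automorphic      : ∀ γ → SLℤ γ → ∀ z → GL z → f (embed γ · z) ≡ f z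
        eigenfunction    : ∀ D → Central D → ∃[ eig ]
          Acts D (Iᵥ v) (λ g → eig *ᶜ Iᵥ v g) × Acts D f (λ g → eig *ᶜ f g)
        cuspidal         : Cuspidal f

    -- Eigenfunction of the Hecke operator f(z) ↦ Σ_{α ∈ Γ\ΓgΓ} f(αz) for
    -- every integral g of positive determinant; these operators span the
    -- Hecke ring.
    HeckeEigenfunction : (Mat n → ℂ) → Set
    HeckeEigenfunction f = ∀ g → + 0 ℤ.< det g →
      ∀ αs → HeckeRepresentatives g αs →
      ∃[ eig ] ∀ z → GL z →
        foldr (λ α s → f (embed α · z) +ᶜ s) 0ᶜ αs ≡ eig *ᶜ f z

    record HeckeMaassForm (v : Fin n-1 → ℂ) (f : Mat n → ℂ) : Set where
      field
        maassForm          : MaassForm v f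
        heckeEigenfunction : HeckeEigenfunction f

    SelfDual : (Mat n → ℂ) → Set
    SelfDual f = ∀ z z⁻¹ → Inverse z z⁻¹ → f (w · z⁻¹ ᵀ · w) ≡ f z

    --------------------------------------------------------------------
    -- Fourier coefficients

    -- ψ_{1,…,1,ε}
    ψ : Sign → Mat n → ℂ
    ψ s u = e (fromSign s * u zero (suc zero)
               + sum (λ (i : Fin k) → u (suc (inject₁ i)) (suc (suc i))))

    -- L = W_J(z, v, ψ_{1,…,1,ε}): the value at v of the entire function
    -- which agrees with Jacquet's integral when all Re v_j are large.
    IsJacquetWhittaker : Sign → Mat n → (Fin n-1 → ℂ) → ℂ → Set
    IsJacquetWhittaker s z v L = Σ[ W ∈ ((Fin n-1 → ℂ) → ℂ) ]
        Entire W
      × (∃[ σ ] ∀ v′ → (∀ j → σ < re (v′ j)) →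
          HasIntegral (allAbove {n} toℕ)
            (λ x → Iᵥ v′ (w · unipotent toℕ x · z) *ᶜ conj (ψ s (unipotent toℕ x)))
            (W v′))
      × W v ≡ L

    W-J : Mat n → (Fin n-1 → ℂ) → Sign → ℂ
    W-J z v s = the 0ᶜ (IsJacquetWhittaker s z v)

    -- (m_1, …, m_{n-1}) with m_1, …, m_{n-2} ≥ 1 and m_{n-1} ≠ 0; the
    -- components are m_j - 1 for j ≤ n-2, then the sign of m_{n-1} and |m_{n-1}| - 1.
    MIndex : Set
    MIndex = Vec ℕ k × Sign × ℕ

    entries : MIndex → Vec ℤ n-1
    entries (ms , s , l) = Vec.map (λ a → + suc a) ms ∷ʳ (s ◃ suc l)

    fourierTerm : (Fin n-1 → ℂ) → (Vec ℤ n-1 → ℂ) → Mat n →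
                  Mℤ.Mat n-1 → MIndex → ℂ
    fourierTerm v A z γ μ@(_ , s , _) =
      product (λ j → ∣m∣ j ^ʳ (fromℕ (pos j ℕ.* (n ∸ pos j)) * fromℕ 2 ⁻¹)) ⁻¹
        • A (entries μ)
        *ᶜ W-J (yMatrix ∣m∣ · embed (corner γ) · z) v s
      where
      ∣m∣ : Fin n-1 → ℝ
      ∣m∣ j = fromℕ ∣ lookup (entries μ) j ∣

    -- The values of A at vectors not of the form entries μ are irrelevant.
    FourierCoefficients : (Fin n-1 → ℂ) → (Mat n → ℂ) → (Vec ℤ n-1 → ℂ) → Set₁
    FourierCoefficients v f A =
      (𝒯 : Transversal n-1) → let open Transversal 𝒯 in
      ∀ z → GL z → Σ[ a ∈ (Index → ℂ) ]
        (∀ i → HasSum (fourierTerm v A z (rep i)) (a i)) × HasSum a (f z)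

    Normalized : (Vec ℤ n-1 → ℂ) → Set
    Normalized A = A (replicate n-1 (+ 1)) ≡ 1ᶜ

    --------------------------------------------------------------------
    -- Satake parameters

    -- α_1, …, α_n are the roots, with multiplicity, of
    -- X^n + Σ_{j=1}^{n-1} (-1)^j A(1,…,p,…,1) X^{n-j} + (-1)^n.
    SatakeParameters : (Vec ℤ n-1 → ℂ) → ℕ → (Fin n → ℂ) → Set
    SatakeParameters A p α = ∀ X →
      productᶜ (λ i → X -ᶜ α i)
        ≡ X ^ᶜ n
          +ᶜ sumᶜ (λ j → (- 1#) ^ pos j
                         • A (replicate n-1 (+ 1) [ j ]≔ + p)
                         *ᶜ X ^ᶜ (n ∸ pos j))
          +ᶜ ofℝ ((- 1#) ^ n)

    a[_] : (ℕ → Fin n → ℂ) → ℕ → ℕ → ℂ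
    a[ α ] p r = sumᶜ λ i → α p i ^ᶜ r

    WeakRamanujan : (ℕ → Fin n → ℂ) → Set
    WeakRamanujan α = ∃[ ε₁ ] 0# < ε₁ × (∀ p → Prime p → ∀ i →
      ∥ α p i ∥ ≤ fromℕ p ^ʳ (fromℕ 4 ⁻¹ - ε₁))

    RudnickSarnak : (ℕ → Fin n → ℂ) → Set
    RudnickSarnak α = ∀ r → 2 ℕ.≤ r → Summable λ p →
      if does (prime? p)
      then ∥ a[ α ] p r ∥ ^ 2 * log (fromℕ p) ^ 2 * (fromℕ p ^ r) ⁻¹
      else 0#

module Submission where

-- The hypothesis gives |a_f(p^r)|² ≪ p^{2r(1/4-ε)}, so for r ≥ 2 the term at p
-- is ≪ (log p)² p^{-(1/2+2ε)r} ≤ (log p)² p^{-1-4ε} ≪ p^{-1-2ε}, and the sum of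
-- the p^{-1-δ} is dominated by the telescoping sum of the differences
-- (m-1)^{-δ} - m^{-δ}.  All facts about exp and log behind these estimates
-- follow from exp (x + y) = exp x exp y and exp x ≥ 1 + x.

open import Defs
open import Algebra.Bundles using (CommutativeRing)
open import Axiom.ExcludedMiddle using (ExcludedMiddle)
open import Data.Bool.Base using (if_then_else_)
open import Data.Empty using (⊥-elim)
open import Data.Fin.Base using (Fin; zero; suc; toℕ)
open import Data.Integer.Base as ℤ using (ℤ; +_; -[1+_])
import Data.Integer.Properties as ℤ
open import Data.Maybe.Base using (Maybe; just; nothing)
open import Data.Nat.Base as ℕ using (ℕ; zero; suc; z≤n; s≤s; _!)
import Data.Nat.Properties as ℕ
open import Data.Nat.Primality using (Prime; prime?; ¬prime[0])
open import Data.Product.Base using (∃; ∃-syntax; _×_; _,_; proj₁; proj₂)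
open import Data.Sum.Base using (_⊎_; inj₁; inj₂; [_,_]′)
open import Data.Vec.Base using (Vec)
open import Function.Base using (_∘_)
open import Level using (0ℓ)
open import Relation.Binary.Bundles using (StrictPartialOrder)
open import Relation.Binary.Definitions using (tri<; tri≈; tri>)
open import Relation.Binary.PropositionalEquality
  using (_≡_; refl; sym; trans; cong; cong₂; subst; subst₂)
open import Relation.Binary.Structures using (IsStrictTotalOrder; IsTotalOrder)
open import Relation.Nullary.Decidable.Core using (Dec; yes; no; does)
open import Relation.Nullary.Negation.Core using (¬_)

-- The surplus 4ε is halved: 2ε absorbs (log p)² through ε log p ≤ p^ε, and the remaining 2ε is the
-- δ of the telescoping sum. The bulk of the work is analytic, since `exp`, `log` and `sqrt` are
-- descriptions that carry information only once a witness exists. Convergence of the exponential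
-- series comes from `supremum`. The addition law comes from a Cauchy product whose coefficients are
-- identified by the formal differential equation u' = x u. A second supremum shows that `exp`
-- reaches every positive real, which yields `log` and then `sqrt`. The tangent inequality
-- `exp-growth` does the work of a derivative wherever increments of `exp` or `log` are compared.

module Analysis (em : ExcludedMiddle 0ℓ) (ℛ : CompleteOrderedField) where

  open Theory em ℛ hiding (distribˡ; distribʳ; b; w)

  ℝ-commutativeRing : CommutativeRing 0ℓ 0ℓ
  ℝ-commutativeRing = record { isCommutativeRing = isCommutativeRing }

  open CommutativeRing ℝ-commutativeRing
    using (+-assoc; +-comm; +-identityˡ; +-identityʳ; -‿inverseʳ;
           *-assoc; *-comm; *-identityˡ; *-identityʳ; distribˡ; distribʳ;
           zeroˡ; zeroʳ; ring; commutativeSemiring; +-group; +-abelianGroup)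
  open import Algebra.Properties.CommutativeSemiring.Exp commutativeSemiring using (^-distrib-*)
  open import Algebra.Properties.Ring ring using (-‿distribˡ-*; -‿distribʳ-*)
  open import Algebra.Properties.Group +-group using (ε⁻¹≈ε; ⁻¹-involutive)
  open import Algebra.Properties.AbelianGroup +-abelianGroup using (⁻¹-∙-comm)
  open import Algebra.Solver.Ring.AlmostCommutativeRing
    using (fromCommutativeRing; _-Raw-AlmostCommutative⟶_)

  <-strictPartialOrder : StrictPartialOrder 0ℓ 0ℓ 0ℓ
  <-strictPartialOrder = record
    { isStrictPartialOrder = IsStrictTotalOrder.isStrictPartialOrder isStrictTotalOrder }

  open IsStrictTotalOrder isStrictTotalOrder using (compare)
    renaming (trans to <-trans; irrefl to <-irrefl)
  open import Relation.Binary.Reasoning.StrictPartialOrder <-strictPartialOrder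
  open import Relation.Binary.Construct.StrictToNonStrict _≡_ _<_
    using () renaming (isTotalOrder to ≤-isTotalOrder′)

  open IsTotalOrder (≤-isTotalOrder′ isStrictTotalOrder)
    using () renaming (trans to ≤-trans; antisym to ≤-antisym; total to ≤-total)

  -- Ring solver with integer coefficients

  fromℕ-+ : ∀ m n → fromℕ (m ℕ.+ n) ≡ fromℕ m + fromℕ n
  fromℕ-+ zero    n = sym (+-identityˡ _)
  fromℕ-+ (suc m) n = trans (cong (λ x → 1# + x) (fromℕ-+ m n)) (sym (+-assoc _ _ _))

  fromℕ-* : ∀ m n → fromℕ (m ℕ.* n) ≡ fromℕ m * fromℕ n
  fromℕ-* zero    n = sym (zeroˡ _)
  fromℕ-* (suc m) n = begin-equality
    fromℕ (n ℕ.+ m ℕ.* n)       ≡⟨ fromℕ-+ n (m ℕ.* n) ⟩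
    fromℕ n + fromℕ (m ℕ.* n)   ≡⟨ cong₂ _+_ (sym (*-identityˡ _)) (fromℕ-* m n) ⟩
    1# * fromℕ n + fromℕ m * fromℕ n ≡⟨ sym (distribʳ _ _ _) ⟩
    (1# + fromℕ m) * fromℕ n ∎

  fromℤ-neg : ∀ i → fromℤ (ℤ.- i) ≡ - fromℤ i
  fromℤ-neg (+ zero)  = sym ε⁻¹≈ε
  fromℤ-neg (+ suc n) = refl
  fromℤ-neg -[1+ n ]  = sym (⁻¹-involutive _)

  -- Done by hand because it feeds `fromℤ-⊖`, hence the coefficient morphism from which the ring
  -- solver is built.
  1+x-1+y : ∀ x y → x - y ≡ (1# + x) - (1# + y)
  1+x-1+y x y = sym (begin-equality
    (1# + x) + - (1# + y)      ≡⟨ cong (λ z → (1# + x) + z) (sym (⁻¹-∙-comm 1# y)) ⟩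
    (1# + x) + (- 1# + - y)    ≡⟨ cong (λ z → z + (- 1# + - y)) (+-comm 1# x) ⟩
    (x + 1#) + (- 1# + - y)    ≡⟨ +-assoc x 1# _ ⟩
    x + (1# + (- 1# + - y))    ≡⟨ cong (λ z → x + z) (sym (+-assoc 1# (- 1#) (- y))) ⟩
    x + ((1# + - 1#) + - y)    ≡⟨ cong (λ z → x + (z + - y)) (-‿inverseʳ 1#) ⟩
    x + (0# + - y)             ≡⟨ cong (λ z → x + z) (+-identityˡ _) ⟩
    x + - y                    ∎)

  fromℤ-⊖ : ∀ m n → fromℤ (m ℤ.⊖ n) ≡ fromℕ m - fromℕ n
  fromℤ-⊖ m       zero    = sym (trans (cong (λ z → fromℕ m + z) ε⁻¹≈ε) (+-identityʳ _))
  fromℤ-⊖ zero    (suc n) = sym (+-identityˡ _)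
  fromℤ-⊖ (suc m) (suc n) =
    trans (cong fromℤ (ℤ.[1+m]⊖[1+n]≡m⊖n m n)) (trans (fromℤ-⊖ m n) (1+x-1+y _ _))

  fromℤ-+ : ∀ i j → fromℤ (i ℤ.+ j) ≡ fromℤ i + fromℤ j
  fromℤ-+ (+ m)    (+ n)    = fromℕ-+ m n
  fromℤ-+ (+ m)    -[1+ n ] = fromℤ-⊖ m (suc n)
  fromℤ-+ -[1+ m ] (+ n)    = trans (fromℤ-⊖ n (suc m)) (+-comm _ _)
  fromℤ-+ -[1+ m ] -[1+ n ] = trans
    (cong (-_ ∘ fromℕ ∘ suc) (sym (ℕ.+-suc m n)))
    (trans (cong -_ (fromℕ-+ (suc m) (suc n))) (sym (⁻¹-∙-comm _ _)))

  fromℤ-pos* : ∀ m j → fromℤ (+ m ℤ.* j) ≡ fromℕ m * fromℤ j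
  fromℤ-pos* zero    j = sym (zeroˡ _)
  fromℤ-pos* (suc m) j = begin-equality
    fromℤ (ℤ.suc (+ m) ℤ.* j)        ≡⟨ cong fromℤ (ℤ.suc-* (+ m) j) ⟩
    fromℤ (j ℤ.+ + m ℤ.* j)          ≡⟨ fromℤ-+ j (+ m ℤ.* j) ⟩
    fromℤ j + fromℤ (+ m ℤ.* j)      ≡⟨ cong₂ _+_ (sym (*-identityˡ _)) (fromℤ-pos* m j) ⟩
    1# * fromℤ j + fromℕ m * fromℤ j ≡⟨ sym (distribʳ _ _ _) ⟩
    (1# + fromℕ m) * fromℤ j ∎

  fromℤ-* : ∀ i j → fromℤ (i ℤ.* j) ≡ fromℤ i * fromℤ j
  fromℤ-* (+ m)    j = fromℤ-pos* m j
  fromℤ-* -[1+ m ] j = begin-equality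
    fromℤ ((ℤ.- (+ suc m)) ℤ.* j)  ≡⟨ cong fromℤ (sym (ℤ.neg-distribˡ-* (+ suc m) j)) ⟩
    fromℤ (ℤ.- (+ suc m ℤ.* j))    ≡⟨ fromℤ-neg (+ suc m ℤ.* j) ⟩
    - fromℤ (+ suc m ℤ.* j)        ≡⟨ cong -_ (fromℤ-pos* (suc m) j) ⟩
    - (fromℕ (suc m) * fromℤ j)    ≡⟨ -‿distribˡ-* _ _ ⟩
    - fromℕ (suc m) * fromℤ j      ∎

  -- Differs from fromℤ only in that 1 is sent to 1# itself rather than to
  -- 1# + 0#, so that con (+ 1) denotes 1# in solver goals.
  coefficient : ℤ → ℝ
  coefficient (+ 1) = 1#
  coefficient i     = fromℤ i

  coefficient≡fromℤ : ∀ i → coefficient i ≡ fromℤ i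
  coefficient≡fromℤ (+ 0)           = refl
  coefficient≡fromℤ (+ 1)           = sym (+-identityʳ 1#)
  coefficient≡fromℤ (+ suc (suc n)) = refl
  coefficient≡fromℤ -[1+ n ]        = refl

  coefficient-morphism :
    ℤ.+-*-rawRing -Raw-AlmostCommutative⟶ fromCommutativeRing ℝ-commutativeRing
  coefficient-morphism = record
    { ⟦_⟧    = coefficient
    ; +-homo = λ i j → trans (coefficient≡fromℤ (i ℤ.+ j)) (trans (fromℤ-+ i j)
        (sym (cong₂ _+_ (coefficient≡fromℤ i) (coefficient≡fromℤ j))))
    ; *-homo = λ i j → trans (coefficient≡fromℤ (i ℤ.* j)) (trans (fromℤ-* i j)
        (sym (cong₂ _*_ (coefficient≡fromℤ i) (coefficient≡fromℤ j))))
    ; -‿homo = λ i → trans (coefficient≡fromℤ (ℤ.- i)) (trans (fromℤ-neg i)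
        (sym (cong -_ (coefficient≡fromℤ i))))
    ; 0-homo = refl
    ; 1-homo = refl
    }

  coefficient-≟ : ∀ i j → Maybe (coefficient i ≡ coefficient j)
  coefficient-≟ i j with i ℤ.≟ j
  ... | yes i≡j = just (cong coefficient i≡j)
  ... | no  _   = nothing

  open import Algebra.Solver.Ring ℤ.+-*-rawRing
    (fromCommutativeRing ℝ-commutativeRing) coefficient-morphism coefficient-≟

  pattern :0 = con (+ 0)
  pattern :1 = con (+ 1)

  -- Ordered fields

  ≤-refl : ∀ {x} → x ≤ x
  ≤-refl = inj₂ refl

  <⇒≤ : ∀ {x y} → x < y → x ≤ y
  <⇒≤ = inj₁

  <⇒≱ : ∀ {x y} → x < y → ¬ y ≤ x
  <⇒≱ x<y (inj₁ y<x)  = <-irrefl refl (<-trans x<y y<x)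
  <⇒≱ x<y (inj₂ refl) = <-irrefl refl x<y

  ≮⇒≥ : ∀ {x y} → ¬ x < y → y ≤ x
  ≮⇒≥ {x} {y} x≮y with compare x y
  ... | tri< x<y _ _ = ⊥-elim (x≮y x<y)
  ... | tri≈ _ x≡y _ = inj₂ (sym x≡y)
  ... | tri> _ _ y<x = inj₁ y<x

  ≰⇒> : ∀ {x y} → ¬ x ≤ y → y < x
  ≰⇒> {x} {y} x≰y with compare x y
  ... | tri< x<y _ _ = ⊥-elim (x≰y (inj₁ x<y))
  ... | tri≈ _ x≡y _ = ⊥-elim (x≰y (inj₂ x≡y))
  ... | tri> _ _ y<x = y<x

  +-monoˡ-≤ : ∀ {x y} z → x ≤ y → x + z ≤ y + z
  +-monoˡ-≤ z (inj₁ x<y)  = inj₁ (+-mono-< _ _ z x<y)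
  +-monoˡ-≤ z (inj₂ refl) = inj₂ refl

  +-mono-≤ : ∀ {x y u v} → x ≤ y → u ≤ v → x + u ≤ y + v
  +-mono-≤ {x} {y} {u} {v} x≤y u≤v = begin
    x + u ≤⟨ +-monoˡ-≤ u x≤y ⟩
    y + u ≡⟨ +-comm y u ⟩
    u + y ≤⟨ +-monoˡ-≤ y u≤v ⟩
    v + y ≡⟨ +-comm v y ⟩
    y + v ∎

  +-mono-<-< : ∀ {x y u v} → x < y → u < v → x + u < y + v
  +-mono-<-< {x} {y} {u} {v} x<y u<v = begin-strict
    x + u <⟨ +-mono-< _ _ u x<y ⟩
    y + u ≡⟨ +-comm y u ⟩
    u + y <⟨ +-mono-< _ _ y u<v ⟩
    v + y ≡⟨ +-comm v y ⟩
    y + v ∎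

  -- The format for combining order with the ring solver: the caller names a visibly nonnegative
  -- `d`, and the solver checks that it is the difference.
  diff-≤ : ∀ {x y} d → 0# ≤ d → y - x ≡ d → x ≤ y
  diff-≤ {x} {y} d 0≤d refl = begin
    x            ≡⟨ solve 1 (λ x → x := :0 :+ x) refl x ⟩
    0# + x       ≤⟨ +-monoˡ-≤ x 0≤d ⟩
    y - x + x    ≡⟨ solve 2 (λ x y → y :- x :+ x := y) refl x y ⟩
    y ∎

  diff-< : ∀ {x y} d → 0# < d → y - x ≡ d → x < y
  diff-< {x} {y} d 0<d refl = begin-strict
    x            ≡⟨ solve 1 (λ x → x := :0 :+ x) refl x ⟩
    0# + x       <⟨ +-mono-< _ _ x 0<d ⟩
    y - x + x    ≡⟨ solve 2 (λ x y → y :- x :+ x := y) refl x y ⟩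
    y ∎

  ≤⇒0≤ : ∀ {x y} → x ≤ y → 0# ≤ y - x
  ≤⇒0≤ {x} {y} x≤y = begin
    0#     ≡⟨ sym (-‿inverseʳ x) ⟩
    x - x  ≤⟨ +-monoˡ-≤ (- x) x≤y ⟩
    y - x  ∎

  <⇒0< : ∀ {x y} → x < y → 0# < y - x
  <⇒0< {x} {y} x<y = begin-strict
    0#     ≡⟨ sym (-‿inverseʳ x) ⟩
    x - x  <⟨ +-mono-< _ _ (- x) x<y ⟩
    y - x  ∎

  neg-≤ : ∀ {x y} → x ≤ y → - y ≤ - x
  neg-≤ {x} {y} x≤y =
    diff-≤ (y - x) (≤⇒0≤ x≤y) (solve 2 (λ x y → :- x :- :- y := y :- x) refl x y)

  neg-< : ∀ {x y} → x < y → - y < - x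
  neg-< {x} {y} x<y =
    diff-< (y - x) (<⇒0< x<y) (solve 2 (λ x y → :- x :- :- y := y :- x) refl x y)

  +-nonneg : ∀ {x y} → 0# ≤ x → 0# ≤ y → 0# ≤ x + y
  +-nonneg {x} {y} 0≤x 0≤y = begin
    0#      ≡⟨ sym (+-identityˡ 0#) ⟩
    0# + 0# ≤⟨ +-mono-≤ 0≤x 0≤y ⟩
    x + y   ∎

  *-nonneg : ∀ {x y} → 0# ≤ x → 0# ≤ y → 0# ≤ x * y
  *-nonneg (inj₁ 0<x)  (inj₁ 0<y)  = inj₁ (*-pos _ _ 0<x 0<y)
  *-nonneg (inj₂ refl) _           = inj₂ (sym (zeroˡ _))
  *-nonneg (inj₁ _)    (inj₂ refl) = inj₂ (sym (zeroʳ _))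

  *-monoʳ-≤ : ∀ {x y} z → 0# ≤ z → x ≤ y → z * x ≤ z * y
  *-monoʳ-≤ {x} {y} z 0≤z x≤y = diff-≤ (z * (y - x)) (*-nonneg 0≤z (≤⇒0≤ x≤y))
    (solve 3 (λ x y z → z :* y :- z :* x := z :* (y :- x)) refl x y z)

  *-monoˡ-≤ : ∀ {x y} z → 0# ≤ z → x ≤ y → x * z ≤ y * z
  *-monoˡ-≤ z 0≤z x≤y = subst₂ _≤_ (*-comm z _) (*-comm z _) (*-monoʳ-≤ z 0≤z x≤y)

  *-mono-≤ : ∀ {x y u v} → 0# ≤ u → 0# ≤ y → x ≤ y → u ≤ v → x * u ≤ y * v
  *-mono-≤ 0≤u 0≤y x≤y u≤v = ≤-trans (*-monoˡ-≤ _ 0≤u x≤y) (*-monoʳ-≤ _ 0≤y u≤v)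

  *-monoʳ-< : ∀ {x y} z → 0# < z → x < y → z * x < z * y
  *-monoʳ-< {x} {y} z 0<z x<y = diff-< (z * (y - x)) (*-pos _ _ 0<z (<⇒0< x<y))
    (solve 3 (λ x y z → z :* y :- z :* x := z :* (y :- x)) refl x y z)

  *-cancelˡ-≤ : ∀ {x y} z → 0# < z → z * x ≤ z * y → x ≤ y
  *-cancelˡ-≤ z 0<z zx≤zy = ≮⇒≥ λ y<x → <⇒≱ (*-monoʳ-< z 0<z y<x) zx≤zy

  *-cancelˡ-≡ : ∀ {x y} z → 0# < z → z * x ≡ z * y → x ≡ y
  *-cancelˡ-≡ z 0<z zx≡zy = ≤-antisym
    (*-cancelˡ-≤ z 0<z (inj₂ zx≡zy)) (*-cancelˡ-≤ z 0<z (inj₂ (sym zx≡zy)))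

  square-nonneg : ∀ x → 0# ≤ x * x
  square-nonneg x = [ (λ 0≤x → *-nonneg 0≤x 0≤x) , (λ x≤0 →
    subst (λ y → 0# ≤ y) (solve 1 (λ x → (:0 :- x) :* (:0 :- x) := x :* x) refl x)
      (*-nonneg (≤⇒0≤ x≤0) (≤⇒0≤ x≤0))) ]′ (≤-total 0# x)

  0≤1 : 0# ≤ 1#
  0≤1 = subst (λ x → 0# ≤ x) (*-identityˡ 1#) (square-nonneg 1#)

  0<1 : 0# < 1#
  0<1 with 0≤1
  ... | inj₁ 0<1 = 0<1
  ... | inj₂ 0≡1 = ⊥-elim (0≢1 0≡1)

  x≤1+x : ∀ x → x ≤ 1# + x
  x≤1+x x = diff-≤ 1# 0≤1 (solve 1 (λ x → :1 :+ x :- x := :1) refl x)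

  fromℕ-nonneg : ∀ n → 0# ≤ fromℕ n
  fromℕ-nonneg zero    = ≤-refl
  fromℕ-nonneg (suc n) = +-nonneg 0≤1 (fromℕ-nonneg n)

  fromℕ-suc-pos : ∀ n → 0# < fromℕ (suc n)
  fromℕ-suc-pos n = begin-strict
    0#           <⟨ 0<1 ⟩
    1#           ≡⟨ sym (+-identityʳ 1#) ⟩
    1# + 0#      ≤⟨ +-mono-≤ ≤-refl (fromℕ-nonneg n) ⟩
    1# + fromℕ n ∎

  inverse-pos : ∀ {x} → 0# < x → x * x ⁻¹ ≡ 1#
  inverse-pos 0<x = *-inverse _ λ x≡0 → <-irrefl (sym x≡0) 0<x

  ⁻¹-pos : ∀ {x} → 0# < x → 0# < x ⁻¹
  ⁻¹-pos {x} 0<x with compare 0# (x ⁻¹)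
  ... | tri< 0<x⁻¹ _ _ = 0<x⁻¹
  ... | tri≈ _ 0≡x⁻¹ _ = ⊥-elim (0≢1 (begin-equality
    0#       ≡⟨ sym (zeroʳ x) ⟩
    x * 0#   ≡⟨ cong (λ y → x * y) 0≡x⁻¹ ⟩
    x * x ⁻¹ ≡⟨ inverse-pos 0<x ⟩
    1#       ∎))
  ... | tri> _ _ x⁻¹<0 = ⊥-elim (<⇒≱ 0<1 (begin
    1#       ≡⟨ sym (inverse-pos 0<x) ⟩
    x * x ⁻¹ ≤⟨ *-monoʳ-≤ x (<⇒≤ 0<x) (<⇒≤ x⁻¹<0) ⟩
    x * 0#   ≡⟨ zeroʳ x ⟩
    0#       ∎))

  ⁻¹-unique : ∀ {x y} → 0# < x → x * y ≡ 1# → y ≡ x ⁻¹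
  ⁻¹-unique 0<x xy≡1 = *-cancelˡ-≡ _ 0<x (trans xy≡1 (sym (inverse-pos 0<x)))

  half : ℝ
  half = fromℕ 2 ⁻¹

  half-pos : 0# < half
  half-pos = ⁻¹-pos (fromℕ-suc-pos 1)

  half+half : ∀ x → half * x + half * x ≡ x
  half+half x = begin-equality
    half * x + half * x  ≡⟨ solve 2 (λ h x → h :* x :+ h :* x := con (+ 2) :* h :* x) refl half x ⟩
    fromℕ 2 * half * x   ≡⟨ cong (λ y → y * x) (inverse-pos (fromℕ-suc-pos 1)) ⟩
    1# * x               ≡⟨ *-identityˡ x ⟩
    x ∎

  -- Absolute value

  abs-cases : ∀ x → (0# ≤ x × abs x ≡ x) ⊎ (x < 0# × abs x ≡ - x)
  abs-cases x with x <? 0#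
  ... | yes x<0 = inj₂ (x<0 , refl)
  ... | no  x≮0 = inj₁ (≮⇒≥ x≮0 , refl)

  0≤x⇒-x≤x : ∀ {x} → 0# ≤ x → - x ≤ x
  0≤x⇒-x≤x {x} 0≤x = diff-≤ (x + x) (+-nonneg 0≤x 0≤x)
    (solve 1 (λ x → x :- :- x := x :+ x) refl x)

  x≤0⇒0≤-x : ∀ {x} → x ≤ 0# → 0# ≤ - x
  x≤0⇒0≤-x {x} x≤0 = subst (λ y → y ≤ - x) ε⁻¹≈ε (neg-≤ x≤0)

  abs-nonneg : ∀ x → 0# ≤ abs x
  abs-nonneg x with abs-cases x
  ... | inj₁ (0≤x , eq) = subst (λ y → 0# ≤ y) (sym eq) 0≤x
  ... | inj₂ (x<0 , eq) = subst (λ y → 0# ≤ y) (sym eq) (x≤0⇒0≤-x (<⇒≤ x<0))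

  x≤abs : ∀ x → x ≤ abs x
  x≤abs x with abs-cases x
  ... | inj₁ (_   , eq) = inj₂ (sym eq)
  ... | inj₂ (x<0 , eq) = ≤-trans (<⇒≤ x<0) (abs-nonneg x)

  -x≤abs : ∀ x → - x ≤ abs x
  -x≤abs x with abs-cases x
  ... | inj₁ (0≤x , eq) = subst (λ y → - x ≤ y) (sym eq) (0≤x⇒-x≤x 0≤x)
  ... | inj₂ (_   , eq) = inj₂ (sym eq)

  abs-≤ : ∀ {x y} → x ≤ y → - x ≤ y → abs x ≤ y
  abs-≤ {x} x≤y -x≤y with abs-cases x
  ... | inj₁ (_ , eq) = subst (λ z → z ≤ _) (sym eq) x≤y
  ... | inj₂ (_ , eq) = subst (λ z → z ≤ _) (sym eq) -x≤y

  abs-< : ∀ {x y} → x < y → - x < y → abs x < y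
  abs-< {x} x<y -x<y with abs-cases x
  ... | inj₁ (_ , eq) = subst (λ z → z < _) (sym eq) x<y
  ... | inj₂ (_ , eq) = subst (λ z → z < _) (sym eq) -x<y

  0≤x⇒abs≡x : ∀ {x} → 0# ≤ x → abs x ≡ x
  0≤x⇒abs≡x 0≤x = ≤-antisym (abs-≤ ≤-refl (0≤x⇒-x≤x 0≤x)) (x≤abs _)

  abs-+ : ∀ x y → abs (x + y) ≤ abs x + abs y
  abs-+ x y = abs-≤ (+-mono-≤ (x≤abs x) (x≤abs y))
    (subst (λ z → z ≤ abs x + abs y) (⁻¹-∙-comm x y) (+-mono-≤ (-x≤abs x) (-x≤abs y)))

  abs-* : ∀ x y → abs (x * y) ≤ abs x * abs y
  abs-* x y with abs-cases x | abs-cases y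
  ... | inj₁ (0≤x , ex) | inj₁ (0≤y , ey) rewrite ex | ey =
    inj₂ (0≤x⇒abs≡x (*-nonneg 0≤x 0≤y))
  ... | inj₁ (0≤x , ex) | inj₂ (y<0 , ey) rewrite ex | ey = abs-≤
    (diff-≤ (x * - y + x * - y) (+-nonneg 0≤x*-y 0≤x*-y)
      (solve 2 (λ x y → x :* :- y :- x :* y := x :* :- y :+ x :* :- y) refl x y))
    (inj₂ (-‿distribʳ-* x y))
    where 0≤x*-y = *-nonneg 0≤x (x≤0⇒0≤-x (<⇒≤ y<0))
  ... | inj₂ (x<0 , ex) | inj₁ (0≤y , ey) rewrite ex | ey = abs-≤
    (diff-≤ (- x * y + - x * y) (+-nonneg 0≤-x*y 0≤-x*y)
      (solve 2 (λ x y → :- x :* y :- x :* y := :- x :* y :+ :- x :* y) refl x y))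
    (inj₂ (-‿distribˡ-* x y))
    where 0≤-x*y = *-nonneg (x≤0⇒0≤-x (<⇒≤ x<0)) 0≤y
  ... | inj₂ (x<0 , ex) | inj₂ (y<0 , ey) rewrite ex | ey = abs-≤
    (inj₂ (solve 2 (λ x y → x :* y := :- x :* :- y) refl x y))
    (diff-≤ (- x * - y + - x * - y) (+-nonneg 0≤-x*-y 0≤-x*-y)
      (solve 2 (λ x y → :- x :* :- y :- :- (x :* y) := :- x :* :- y :+ :- x :* :- y) refl x y))
    where 0≤-x*-y = *-nonneg (x≤0⇒0≤-x (<⇒≤ x<0)) (x≤0⇒0≤-x (<⇒≤ y<0))

  -- Limits

  Null : (ℕ → ℝ) → Set
  Null s = ∀ ε → 0# < ε → ∃[ N ] ∀ m → N ℕ.≤ m → abs (s m) < ε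

  infix 4 _⟶_
  -- Reducing to null sequences turns each limit law into a ring identity for the differences plus
  -- closure properties of `Null`.
  _⟶_ : (ℕ → ℝ) → ℝ → Set
  s ⟶ L = Null (λ m → s m - L)

  null-cong : ∀ {s t} → (∀ m → s m ≡ t m) → Null s → Null t
  null-cong s≗t s⟶0 ε 0<ε =
    let N , bound = s⟶0 ε 0<ε
    in  N , λ m N≤m → subst (λ x → abs x < ε) (s≗t m) (bound m N≤m)

  null-squeeze : ∀ {s t} → (∀ m → abs (s m) ≤ t m) → Null t → Null s
  null-squeeze {s} {t} s≤t t⟶0 ε 0<ε =
    let N , bound = t⟶0 ε 0<ε
    in  N , λ m N≤m → begin-strict
          abs (s m) ≤⟨ s≤t m ⟩
          t m       ≤⟨ x≤abs (t m) ⟩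
          abs (t m) <⟨ bound m N≤m ⟩
          ε         ∎

  null-+ : ∀ {s t} → Null s → Null t → Null (λ m → s m + t m)
  null-+ {s} {t} s⟶0 t⟶0 ε 0<ε =
    let 0<ε/2 = *-pos _ _ half-pos 0<ε
        M , s-bound = s⟶0 (half * ε) 0<ε/2
        N , t-bound = t⟶0 (half * ε) 0<ε/2
    in  M ℕ.⊔ N , λ m M⊔N≤m → begin-strict
          abs (s m + t m)       ≤⟨ abs-+ (s m) (t m) ⟩
          abs (s m) + abs (t m) <⟨ +-mono-<-<
            (s-bound m (ℕ.≤-trans (ℕ.m≤m⊔n M N) M⊔N≤m))
            (t-bound m (ℕ.≤-trans (ℕ.m≤n⊔m M N) M⊔N≤m)) ⟩
          half * ε + half * ε   ≡⟨ half+half ε ⟩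
          ε                     ∎

  -- The bound on `t` is asked for only eventually because that is what `lim-bounded` supplies for a
  -- convergent sequence.
  null-*-bounded : ∀ {s} (t : ℕ → ℝ) K → 0# < K → (∃[ M ] ∀ m → M ℕ.≤ m → abs (t m) ≤ K) →
                   Null s → Null (λ m → s m * t m)
  null-*-bounded {s} t K 0<K (M , t-bound) s⟶0 ε 0<ε =
    let N , s-bound = s⟶0 (K ⁻¹ * ε) (*-pos _ _ (⁻¹-pos 0<K) 0<ε)
    in  M ℕ.⊔ N , λ m M⊔N≤m → begin-strict
          abs (s m * t m)       ≤⟨ abs-* (s m) (t m) ⟩
          abs (s m) * abs (t m) ≤⟨ *-monoʳ-≤ _ (abs-nonneg (s m))
                                     (t-bound m (ℕ.≤-trans (ℕ.m≤m⊔n M N) M⊔N≤m)) ⟩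
          abs (s m) * K         ≡⟨ *-comm _ K ⟩
          K * abs (s m)         <⟨ *-monoʳ-< K 0<K
                                     (s-bound m (ℕ.≤-trans (ℕ.m≤n⊔m M N) M⊔N≤m)) ⟩
          K * (K ⁻¹ * ε)        ≡⟨ sym (*-assoc K (K ⁻¹) ε) ⟩
          K * K ⁻¹ * ε          ≡⟨ cong (λ x → x * ε) (inverse-pos 0<K) ⟩
          1# * ε                ≡⟨ *-identityˡ ε ⟩
          ε                     ∎

  lim-bounded : ∀ {s L} → s ⟶ L → ∃[ M ] ∀ m → M ℕ.≤ m → abs (s m) ≤ abs L + 1#
  lim-bounded {s} {L} s⟶L =
    let M , bound = s⟶L 1# 0<1
    in  M , λ m M≤m → begin
          abs (s m)               ≡⟨ cong abs (solve 2 (λ s L → s := L :+ (s :- L)) refl (s m) L) ⟩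
          abs (L + (s m - L))     ≤⟨ abs-+ L (s m - L) ⟩
          abs L + abs (s m - L)   ≤⟨ +-mono-≤ ≤-refl (<⇒≤ (bound m M≤m)) ⟩
          abs L + 1#              ∎

  abs+1-pos : ∀ x → 0# < abs x + 1#
  abs+1-pos x = begin-strict
    0#         <⟨ 0<1 ⟩
    1#         ≡⟨ sym (+-identityˡ 1#) ⟩
    0# + 1#    ≤⟨ +-monoˡ-≤ 1# (abs-nonneg x) ⟩
    abs x + 1# ∎

  lim-const : ∀ L → (λ _ → L) ⟶ L
  lim-const L ε 0<ε = 0 , λ _ _ →
    subst (λ x → x < ε) (sym (trans (cong abs (-‿inverseʳ L)) (0≤x⇒abs≡x ≤-refl))) 0<ε

  lim-+ : ∀ {s t L M} → s ⟶ L → t ⟶ M → (λ m → s m + t m) ⟶ L + M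
  lim-+ {s} {t} {L} {M} s⟶L t⟶M = null-cong
    (λ m → solve 4 (λ s t L M → s :- L :+ (t :- M) := s :+ t :- (L :+ M)) refl (s m) (t m) L M)
    (null-+ s⟶L t⟶M)

  lim-* : ∀ {s t L M} → s ⟶ L → t ⟶ M → (λ m → s m * t m) ⟶ L * M
  lim-* {s} {t} {L} {M} s⟶L t⟶M = null-cong
    (λ m → solve 4 (λ s t L M → (s :- L) :* t :+ (t :- M) :* L := s :* t :- L :* M) refl
             (s m) (t m) L M)
    (null-+ (null-*-bounded t _ (abs+1-pos M) (lim-bounded t⟶M) s⟶L)
            (null-*-bounded (λ _ → L) _ (abs+1-pos L) (lim-bounded (lim-const L)) t⟶M))

  lim-neg : ∀ {s L} → s ⟶ L → (λ m → - s m) ⟶ - L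
  lim-neg {s} {L} s⟶L = null-cong
    (λ m → solve 2 (λ s L → (s :- L) :* :- :1 := :- s :- :- L) refl (s m) L)
    (null-*-bounded (λ _ → - 1#) _ (abs+1-pos (- 1#)) (lim-bounded (lim-const (- 1#))) s⟶L)

  lim-subsequence : ∀ {s L} (φ : ℕ → ℕ) → (∀ m → m ℕ.≤ φ m) → s ⟶ L → s ∘ φ ⟶ L
  lim-subsequence φ m≤φm s⟶L ε 0<ε =
    let N , bound = s⟶L ε 0<ε
    in  N , λ m N≤m → bound (φ m) (ℕ.≤-trans N≤m (m≤φm m))

  lim-shift : ∀ {s L} → s ∘ suc ⟶ L → s ⟶ L
  lim-shift s⟶L ε 0<ε with s⟶L ε 0<ε
  ... | N , bound = suc N , λ { (suc m) (s≤s N≤m) → bound m N≤m }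

  lim-nonneg : ∀ {s L} → (∃[ M ] ∀ m → M ℕ.≤ m → 0# ≤ s m) → s ⟶ L → 0# ≤ L
  lim-nonneg {s} {L} (M , 0≤s) s⟶L = ≮⇒≥ λ L<0 →
    let 0<-L = subst (λ x → x < - L) ε⁻¹≈ε (neg-< L<0)
        N , bound = s⟶L (- L) 0<-L
        m = M ℕ.⊔ N
    in  <⇒≱ (bound m (ℕ.m≤n⊔m M N)) (begin
          - L         ≡⟨ sym (+-identityˡ _) ⟩
          0# - L      ≤⟨ +-monoˡ-≤ (- L) (0≤s m (ℕ.m≤m⊔n M N)) ⟩
          s m - L     ≤⟨ x≤abs _ ⟩
          abs (s m - L) ∎)

  lim-mono : ∀ {s t L M} → (∃[ N ] ∀ m → N ℕ.≤ m → s m ≤ t m) → s ⟶ L → t ⟶ M → L ≤ M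
  lim-mono {s} {t} {L} {M} (N , s≤t) s⟶L t⟶M =
    subst₂ _≤_ (+-identityˡ L) (solve 2 (λ L M → M :- L :+ L := M) refl L M)
      (+-monoˡ-≤ L (lim-nonneg (N , λ m N≤m → ≤⇒0≤ (s≤t m N≤m))
        (lim-+ {t} {λ m → - s m} t⟶M (lim-neg {s} s⟶L))))

  lim-unique : ∀ {s L M} → s ⟶ L → s ⟶ M → L ≡ M
  lim-unique {s} s⟶L s⟶M = ≤-antisym
    (lim-mono {s} {s} (0 , λ _ _ → ≤-refl) s⟶L s⟶M)
    (lim-mono {s} {s} (0 , λ _ _ → ≤-refl) s⟶M s⟶L)

  lim-cong : ∀ {s t L} → (∀ m → s m ≡ t m) → s ⟶ L → t ⟶ L
  lim-cong s≗t = null-cong (λ m → cong (λ x → x - _) (s≗t m))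

  increasing : ∀ {s : ℕ → ℝ} → (∀ m → s m ≤ s (suc m)) → ∀ {m n} → m ℕ.≤ n → s m ≤ s n
  increasing {s} step {m} {n} m≤n = go (ℕ.≤⇒≤′ m≤n) where
    go : ∀ {n} → m ℕ.≤′ n → s m ≤ s n
    go ℕ.≤′-refl       = ≤-refl
    go (ℕ.≤′-step m≤n) = ≤-trans (go m≤n) (step _)

  -- The limit is the supremum L of the values. Excluded middle decides whether some term exceeds L
  -- - ε; if none did, L - ε would be a smaller upper bound.
  monotone-convergence : ∀ s → (∀ m → s m ≤ s (suc m)) → (∃[ B ] ∀ m → s m ≤ B) → ∃[ L ] s ⟶ L
  monotone-convergence s step (B , s≤B)
    with supremum (λ x → ∃[ m ] x ≡ s m) (s 0 , 0 , refl) (B , λ { x (m , refl) → s≤B m })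
  ... | L , s≤L , least = L , λ ε 0<ε → close ε 0<ε em
    where
    close : ∀ ε → 0# < ε → Dec (∃[ N ] L - ε < s N) →
            ∃[ N ] ∀ m → N ℕ.≤ m → abs (s m - L) < ε
    close ε 0<ε (yes (N , L-ε<sN)) = N , λ m N≤m → abs-<
      (begin-strict
        s m - L ≤⟨ +-monoˡ-≤ (- L) (s≤L _ (m , refl)) ⟩
        L - L   ≡⟨ -‿inverseʳ L ⟩
        0#      <⟨ 0<ε ⟩
        ε       ∎)
      (diff-< (s m - (L - ε)) (<⇒0< (begin-strict
        L - ε   <⟨ L-ε<sN ⟩
        s N     ≤⟨ increasing step N≤m ⟩
        s m     ∎))
        (solve 3 (λ s L ε → ε :- :- (s :- L) := s :- (L :- ε)) refl (s m) L ε))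
    close ε 0<ε (no none) = ⊥-elim (<⇒≱ (diff-< ε 0<ε (solve 2 (λ L ε → L :- (L :- ε) := ε) refl L ε))
      (least (L - ε) λ { x (m , refl) → ≮⇒≥ λ L-ε<sm → none (m , L-ε<sm) }))

  -- If no natural number reached x, the sequence `fromℕ` would be bounded and converge to some L;
  -- shifting it by one would give L = 1 + L.
  archimedean : ∀ x → ∃[ n ] x ≤ fromℕ n
  archimedean x = go em where
    go : Dec (∃[ n ] x ≤ fromℕ n) → ∃[ n ] x ≤ fromℕ n
    go (yes found) = found
    go (no  none)  =
      let L , fromℕ⟶L = monotone-convergence fromℕ (x≤1+x ∘ fromℕ)
            (x , λ m → [ (λ x≤m → ⊥-elim (none (m , x≤m))) , (λ m≤x → m≤x) ]′ (≤-total x (fromℕ m)))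
          L≡1+L = lim-unique {fromℕ ∘ suc}
            (lim-subsequence {fromℕ} suc ℕ.n≤1+n fromℕ⟶L)
            (lim-+ {λ _ → 1#} {fromℕ} (lim-const 1#) fromℕ⟶L)
      in  ⊥-elim (<-irrefl L≡1+L (diff-< 1# 0<1 (solve 1 (λ L → :1 :+ L :- L := :1) refl L)))

  -- Series

  -- It peels off the first term, as `sum` does, so inductions pass to the shifted sequence
  -- `a ∘ suc`, and no `Fin` indices appear.
  partialSum : (ℕ → ℝ) → ℕ → ℝ
  partialSum a zero    = 0#
  partialSum a (suc m) = a 0 + partialSum (a ∘ suc) m

  sum≡partialSum : ∀ a m → sum {m} (a ∘ toℕ) ≡ partialSum a m
  sum≡partialSum a zero    = refl
  sum≡partialSum a (suc m) = cong (λ x → a 0 + x) (sum≡partialSum (a ∘ suc) m)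

  ⟶⇒SumsTo : ∀ {a L} → partialSum a ⟶ L → SumsTo a L
  ⟶⇒SumsTo {a} = lim-cong λ m → sym (sum≡partialSum a m)

  SumsTo⇒⟶ : ∀ {a L} → SumsTo a L → partialSum a ⟶ L
  SumsTo⇒⟶ {a} = lim-cong (sum≡partialSum a)

  partialSum-last : ∀ a m → partialSum a (suc m) ≡ partialSum a m + a m
  partialSum-last a zero    = +-comm _ _
  partialSum-last a (suc m) = trans
    (cong (λ x → a 0 + x) (partialSum-last (a ∘ suc) m)) (sym (+-assoc _ _ _))

  partialSum-+ : ∀ a b m → partialSum (λ k → a k + b k) m ≡ partialSum a m + partialSum b m
  partialSum-+ a b zero    = sym (+-identityˡ 0#)
  partialSum-+ a b (suc m) = trans
    (cong (λ x → a 0 + b 0 + x) (partialSum-+ (a ∘ suc) (b ∘ suc) m))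
    (solve 4 (λ a b s t → a :+ b :+ (s :+ t) := a :+ s :+ (b :+ t)) refl (a 0) (b 0) _ _)

  partialSum-cong : ∀ {a b} → (∀ k → a k ≡ b k) → ∀ m → partialSum a m ≡ partialSum b m
  partialSum-cong a≗b zero    = refl
  partialSum-cong a≗b (suc m) = cong₂ _+_ (a≗b 0) (partialSum-cong (a≗b ∘ suc) m)

  partialSum-mono : ∀ {a b} → (∀ k → a k ≤ b k) → ∀ m → partialSum a m ≤ partialSum b m
  partialSum-mono a≤b zero    = ≤-refl
  partialSum-mono a≤b (suc m) = +-mono-≤ (a≤b 0) (partialSum-mono (a≤b ∘ suc) m)

  partialSum-nonneg : ∀ {a} → (∀ k → 0# ≤ a k) → ∀ m → 0# ≤ partialSum a m
  partialSum-nonneg 0≤a zero    = ≤-refl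
  partialSum-nonneg 0≤a (suc m) = +-nonneg (0≤a 0) (partialSum-nonneg (0≤a ∘ suc) m)

  partialSum-step : ∀ {a} → (∀ k → 0# ≤ a k) → ∀ m → partialSum a m ≤ partialSum a (suc m)
  partialSum-step {a} 0≤a m = diff-≤ (a m) (0≤a m) (trans
    (cong (λ x → x - partialSum a m) (partialSum-last a m))
    (solve 2 (λ s a → s :+ a :- s := a) refl (partialSum a m) (a m)))

  BoundedSeries : (ℕ → ℝ) → Set
  BoundedSeries a = ∃[ B ] ∀ m → partialSum a m ≤ B

  nonneg-series : ∀ a → (∀ k → 0# ≤ a k) → BoundedSeries a → ∃[ L ] partialSum a ⟶ L
  nonneg-series a 0≤a = monotone-convergence (partialSum a) (partialSum-step 0≤a)

  bounded-telescope : ∀ a b → (∀ k → 0# ≤ b k) → (∀ k → a k ≤ b k - b (suc k)) → BoundedSeries a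
  bounded-telescope a b 0≤b a≤Δb = b 0 , λ m → begin
    partialSum a m        ≡⟨ sym (+-identityʳ _) ⟩
    partialSum a m + 0#   ≤⟨ +-mono-≤ ≤-refl (0≤b m) ⟩
    partialSum a m + b m  ≤⟨ telescope a b a≤Δb m ⟩
    b 0                   ∎
    where
    -- Keeping the last value `b m` on the left gives a statement that is stable under shifting both
    -- sequences.
    telescope : ∀ a b → (∀ k → a k ≤ b k - b (suc k)) → ∀ m → partialSum a m + b m ≤ b 0
    telescope a b a≤Δb zero    = inj₂ (+-identityˡ _)
    telescope a b a≤Δb (suc m) = begin
      a 0 + partialSum (a ∘ suc) m + b (suc m)   ≡⟨ +-assoc _ _ _ ⟩
      a 0 + (partialSum (a ∘ suc) m + b (suc m)) ≤⟨ +-mono-≤ (a≤Δb 0)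
                                                      (telescope (a ∘ suc) (b ∘ suc) (a≤Δb ∘ suc) m) ⟩
      b 0 - b 1 + b 1 ≡⟨ solve 2 (λ b c → b :- c :+ c := b) refl (b 0) (b 1) ⟩
      b 0             ∎

  bounded-drop : ∀ N {a} → (∀ k → 0# ≤ a k) → BoundedSeries (λ k → a (N ℕ.+ k)) → BoundedSeries a
  bounded-drop zero        0≤a bound = bound
  bounded-drop (suc N) {a} 0≤a bound with bounded-drop N (0≤a ∘ suc) bound
  ... | B , tail≤B = a 0 + B , λ
    -- The tail sum of length 0 is `0#`, so `tail≤B 0` says that B is nonnegative.
    { zero    → +-nonneg (0≤a 0) (tail≤B 0)
    ; (suc m) → +-mono-≤ ≤-refl (tail≤B m) }

  -- The series of a + c lies termwise between 0 and 2c, so it converges as a nonnegative series;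
  -- subtracting the series of c leaves that of a.
  absolute-convergence : ∀ a c → (∀ k → abs (a k) ≤ c k) → BoundedSeries c →
                         ∃[ L ] partialSum a ⟶ L
  absolute-convergence a c |a|≤c (B , c≤B) =
    let L , a+c⟶L = nonneg-series (λ k → a k + c k) 0≤a+c (B + B , λ m → begin
          partialSum (λ k → a k + c k) m   ≤⟨ partialSum-mono a+c≤c+c m ⟩
          partialSum (λ k → c k + c k) m   ≡⟨ partialSum-+ c c m ⟩
          partialSum c m + partialSum c m  ≤⟨ +-mono-≤ (c≤B m) (c≤B m) ⟩
          B + B                            ∎)
        M , c⟶M = nonneg-series c (λ k → ≤-trans (abs-nonneg (a k)) (|a|≤c k)) (B , c≤B)
    in  L - M , lim-cong
          (λ m → trans (cong (λ x → x - partialSum c m) (partialSum-+ a c m))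
            (solve 2 (λ s t → s :+ t :- t := s) refl (partialSum a m) (partialSum c m)))
          (lim-+ {partialSum (λ k → a k + c k)} a+c⟶L (lim-neg {partialSum c} c⟶M))
    where
    a+c≤c+c : ∀ k → a k + c k ≤ c k + c k
    a+c≤c+c k = +-monoˡ-≤ (c k) (≤-trans (x≤abs (a k)) (|a|≤c k))

    0≤a+c : ∀ k → 0# ≤ a k + c k
    0≤a+c k = subst (λ x → 0# ≤ x) (solve 2 (λ a c → c :- :- a := a :+ c) refl (a k) (c k))
      (≤⇒0≤ (≤-trans (-x≤abs (a k)) (|a|≤c k)))

  -- Cauchy products

  -- ∑_{i+j=k} a_i b_j
  convolution : (a b : ℕ → ℝ) → ℕ → ℝ
  convolution a b zero    = a 0 * b 0
  convolution a b (suc k) = a 0 * b (suc k) + convolution (a ∘ suc) b k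

  convolution-+ˡ : ∀ {a u v} b → (∀ i → a i ≡ u i + v i) → ∀ k →
                   convolution a b k ≡ convolution u b k + convolution v b k
  convolution-+ˡ b a≗u+v zero    = trans (cong (λ x → x * b 0) (a≗u+v 0)) (distribʳ _ _ _)
  convolution-+ˡ {a} {u} {v} b a≗u+v (suc k) = trans
    (cong₂ (λ x y → x * b (suc k) + y) (a≗u+v 0) (convolution-+ˡ b (a≗u+v ∘ suc) k))
    (solve 5 (λ u v b s t → (u :+ v) :* b :+ (s :+ t) := u :* b :+ s :+ (v :* b :+ t)) refl
      (u 0) (v 0) (b (suc k)) _ _)

  convolution-*ˡ : ∀ {a u} x b → (∀ i → a i ≡ x * u i) → ∀ k →
                   convolution a b k ≡ x * convolution u b k
  convolution-*ˡ x b a≗xu zero = trans (cong (λ y → y * b 0) (a≗xu 0)) (*-assoc _ _ _)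
  convolution-*ˡ {u = u} x b a≗xu (suc k) = trans
    (cong₂ (λ y z → y * b (suc k) + z) (a≗xu 0) (convolution-*ˡ x b (a≗xu ∘ suc) k))
    (solve 4 (λ x u b s → x :* u :* b :+ x :* s := x :* (u :* b :+ s)) refl x (u 0) (b (suc k)) _)

  convolution-*ʳ : ∀ a {b u} x → (∀ i → b i ≡ x * u i) → ∀ k →
                   convolution a b k ≡ x * convolution a u k
  convolution-*ʳ a {b} {u} x b≗xu zero = trans (cong (λ y → a 0 * y) (b≗xu 0))
    (solve 3 (λ a x u → a :* (x :* u) := x :* (a :* u)) refl (a 0) x (u 0))
  convolution-*ʳ a {b} {u} x b≗xu (suc k) = trans
    (cong₂ (λ y z → a 0 * y + z) (b≗xu (suc k)) (convolution-*ʳ (a ∘ suc) x b≗xu k))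
    (solve 4 (λ x a u s → a :* (x :* u) :+ x :* s := x :* (a :* u :+ s)) refl x (a 0) (u (suc k)) _)

  -- The coefficients of the derivative of the power series ∑ a_i X^i.
  derivative : (ℕ → ℝ) → ℕ → ℝ
  derivative a i = fromℕ (suc i) * a (suc i)

  -- The product rule for formal power series, by induction along f = a₀ + X g, where g has the
  -- coefficients `a ∘ suc`. The factor k + 2 is split as 1 + (k + 1) so that the second part is the
  -- derivative of a convolution with g; `shifted` is the rule (X g)' = g + X g' on coefficients.
  leibniz : ∀ a b k → derivative (convolution a b) k
            ≡ convolution (derivative a) b k + convolution a (derivative b) k
  leibniz a b zero = solve 4
    (λ a₀ a₁ b₀ b₁ → (:1 :+ :0) :* (a₀ :* b₁ :+ a₁ :* b₀)
      := (:1 :+ :0) :* a₁ :* b₀ :+ a₀ :* ((:1 :+ :0) :* b₁))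
    refl (a 0) (a 1) (b 0) (b 1)
  leibniz a b (suc k) = begin-equality
    fromℕ (2 ℕ.+ k) * (a 0 * b (2 ℕ.+ k) + (a 1 * b (suc k) + c))
      ≡⟨ solve 6 (λ n a₀ a₁ b₁ b₂ c → (:1 :+ n) :* (a₀ :* b₂ :+ (a₁ :* b₁ :+ c))
           := (a₁ :* b₁ :+ c) :+ a₀ :* ((:1 :+ n) :* b₂) :+ n :* (a₁ :* b₁ :+ c))
           refl (fromℕ (suc k)) (a 0) (a 1) (b (suc k)) (b (2 ℕ.+ k)) c ⟩
    (a 1 * b (suc k) + c) + a 0 * derivative b (suc k) + derivative (convolution (a ∘ suc) b) k
      ≡⟨ cong (λ x → (a 1 * b (suc k) + c) + a 0 * derivative b (suc k) + x) (leibniz (a ∘ suc) b k) ⟩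
    (a 1 * b (suc k) + c) + a 0 * derivative b (suc k)
      + (convolution (derivative (a ∘ suc)) b k + convolution (a ∘ suc) (derivative b) k)
      ≡⟨ solve 6 (λ a₁ b₁ c d s t → a₁ :* b₁ :+ c :+ d :+ (s :+ t)
           := (:1 :+ :0) :* a₁ :* b₁ :+ (c :+ s) :+ (d :+ t)) refl
           (a 1) (b (suc k)) c (a 0 * derivative b (suc k)) _ _ ⟩
    (fromℕ 1 * a 1) * b (suc k) + (c + convolution (derivative (a ∘ suc)) b k)
      + convolution a (derivative b) (suc k)
      ≡⟨ cong (λ x → (fromℕ 1 * a 1) * b (suc k) + x + convolution a (derivative b) (suc k))
           (sym (convolution-+ˡ b shifted k)) ⟩
    convolution (derivative a) b (suc k) + convolution a (derivative b) (suc k) ∎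
    where
    c = convolution (λ i → a (2 ℕ.+ i)) b k

    shifted : ∀ i → derivative a (suc i) ≡ a (2 ℕ.+ i) + derivative (a ∘ suc) i
    shifted i = solve 2 (λ n a → (:1 :+ n) :* a := a :+ n :* a) refl (fromℕ (suc i)) (a (2 ℕ.+ i))

  -- ∑_{i+j<m} a_i b_j
  triangle : (a b : ℕ → ℝ) → ℕ → ℝ
  triangle a b zero    = 0#
  triangle a b (suc m) = a 0 * partialSum b (suc m) + triangle (a ∘ suc) b m

  partialSum-*ˡ : ∀ x a m → partialSum (λ k → x * a k) m ≡ x * partialSum a m
  partialSum-*ˡ x a zero    = sym (zeroʳ x)
  partialSum-*ˡ x a (suc m) =
    trans (cong (λ y → x * a 0 + y) (partialSum-*ˡ x (a ∘ suc) m)) (sym (distribˡ _ _ _))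

  partialSum-convolution : ∀ a b m → partialSum (convolution a b) m ≡ triangle a b m
  partialSum-convolution a b zero    = refl
  partialSum-convolution a b (suc m) = begin-equality
    a 0 * b 0 + partialSum (λ k → a 0 * b (suc k) + convolution (a ∘ suc) b k) m
      ≡⟨ cong (λ x → a 0 * b 0 + x) (partialSum-+ (λ k → a 0 * b (suc k)) (convolution (a ∘ suc) b) m) ⟩
    a 0 * b 0 + (partialSum (λ k → a 0 * b (suc k)) m + partialSum (convolution (a ∘ suc) b) m)
      ≡⟨ cong₂ (λ x y → a 0 * b 0 + (x + y))
           (partialSum-*ˡ (a 0) (b ∘ suc) m) (partialSum-convolution (a ∘ suc) b m) ⟩
    a 0 * b 0 + (a 0 * partialSum (b ∘ suc) m + triangle (a ∘ suc) b m)
      ≡⟨ solve 4 (λ a b s t → a :* b :+ (a :* s :+ t) := a :* (b :+ s) :+ t) refl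
           (a 0) (b 0) _ _ ⟩
    a 0 * (b 0 + partialSum (b ∘ suc) m) + triangle (a ∘ suc) b m ∎

  -- The far corner of the square: the sum of a_i b_j over i, j < m with i + j ≥ m.
  remainder : (a b : ℕ → ℝ) → ℕ → ℝ
  remainder a b m = partialSum a m * partialSum b m - triangle a b m

  -- The row i = 0 lies wholly in the triangle and cancels. What is left is the column j = m and a
  -- smaller corner, a recursion free of subtraction, which is why `abs-remainder` can compare
  -- corners termwise.
  remainder-suc : ∀ a b m → remainder a b (suc m)
                  ≡ remainder (a ∘ suc) b m + partialSum (a ∘ suc) m * b m
  remainder-suc a b m = begin-equality
    (a 0 + s) * partialSum b (suc m) - (a 0 * partialSum b (suc m) + t)
      ≡⟨ solve 4 (λ a s p t → (a :+ s) :* p :- (a :* p :+ t) := s :* p :- t) refl (a 0) s _ t ⟩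
    s * partialSum b (suc m) - t
      ≡⟨ cong (λ x → s * x - t) (partialSum-last b m) ⟩
    s * (partialSum b m + b m) - t
      ≡⟨ solve 4 (λ s p b t → s :* (p :+ b) :- t := s :* p :- t :+ s :* b) refl s _ (b m) t ⟩
    s * partialSum b m - t + s * b m ∎
    where
    s = partialSum (a ∘ suc) m
    t = triangle (a ∘ suc) b m

  abs-partialSum : ∀ {a c} → (∀ k → abs (a k) ≤ c k) → ∀ m → abs (partialSum a m) ≤ partialSum c m
  abs-partialSum |a|≤c zero    = inj₂ (0≤x⇒abs≡x ≤-refl)
  abs-partialSum |a|≤c (suc m) =
    ≤-trans (abs-+ _ _) (+-mono-≤ (|a|≤c 0) (abs-partialSum (|a|≤c ∘ suc) m))

  abs-remainder : ∀ {a b c d} → (∀ k → abs (a k) ≤ c k) → (∀ k → abs (b k) ≤ d k) →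
                  ∀ m → abs (remainder a b m) ≤ remainder c d m
  abs-remainder |a|≤c |b|≤d zero = inj₂ (0≤x⇒abs≡x (inj₂ (sym 0*0-0≡0)))
    where
    0*0-0≡0 : 0# * 0# - 0# ≡ 0#
    0*0-0≡0 = solve 0 (:0 :* :0 :- :0 := :0) refl
  abs-remainder {a} {b} {c} {d} |a|≤c |b|≤d (suc m) = begin
    abs (remainder a b (suc m))
      ≡⟨ cong abs (remainder-suc a b m) ⟩
    abs (remainder (a ∘ suc) b m + partialSum (a ∘ suc) m * b m)
      ≤⟨ abs-+ _ _ ⟩
    abs (remainder (a ∘ suc) b m) + abs (partialSum (a ∘ suc) m * b m)
      ≤⟨ +-mono-≤ (abs-remainder (|a|≤c ∘ suc) |b|≤d m) (≤-trans (abs-* _ _)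
           (*-mono-≤ (abs-nonneg (b m)) (≤-trans (abs-nonneg _) |Σa|≤Σc) |Σa|≤Σc (|b|≤d m))) ⟩
    remainder (c ∘ suc) d m + partialSum (c ∘ suc) m * d m
      ≡⟨ sym (remainder-suc c d m) ⟩
    remainder c d (suc m) ∎
    where |Σa|≤Σc = abs-partialSum (|a|≤c ∘ suc) m

  triangle-nonneg : ∀ {a b} → (∀ k → 0# ≤ a k) → (∀ k → 0# ≤ b k) → ∀ m → 0# ≤ triangle a b m
  triangle-nonneg 0≤a 0≤b zero    = ≤-refl
  triangle-nonneg 0≤a 0≤b (suc m) = +-nonneg
    (*-nonneg (0≤a 0) (partialSum-nonneg 0≤b (suc m))) (triangle-nonneg (0≤a ∘ suc) 0≤b m)

  -- Indices i < m and j < l satisfy i + j < m + l. The two side lengths are independent so that the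
  -- induction can shrink m alone.
  square≤triangle : ∀ {a b} → (∀ k → 0# ≤ a k) → (∀ k → 0# ≤ b k) → ∀ m l →
                    partialSum a m * partialSum b l ≤ triangle a b (m ℕ.+ l)
  square≤triangle         0≤a 0≤b zero    l = begin
    0# * _         ≡⟨ zeroˡ _ ⟩
    0#             ≤⟨ triangle-nonneg 0≤a 0≤b l ⟩
    triangle _ _ l ∎
  square≤triangle {a} {b} 0≤a 0≤b (suc m) l = begin
    (a 0 + partialSum (a ∘ suc) m) * partialSum b l
      ≡⟨ distribʳ _ _ _ ⟩
    a 0 * partialSum b l + partialSum (a ∘ suc) m * partialSum b l
      ≤⟨ +-mono-≤ (*-monoʳ-≤ (a 0) (0≤a 0)
           (increasing (partialSum-step 0≤b) (ℕ.m≤n+m l (suc m))))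
           (square≤triangle (0≤a ∘ suc) 0≤b m l) ⟩
    a 0 * partialSum b (suc m ℕ.+ l) + triangle (a ∘ suc) b (m ℕ.+ l) ∎

  -- For nonnegative terms the square [0,m)² lies between the triangles of
  -- sizes m and 2m, so its sum has the same limit as theirs; in general the
  -- remainder is dominated by that of the absolute values.
  cauchy-product : ∀ {a b c d X Y Z} → (∀ k → abs (a k) ≤ c k) → (∀ k → abs (b k) ≤ d k) →
    (∃[ U ] partialSum c ⟶ U) → (∃[ V ] partialSum d ⟶ V) → (∃[ W ] partialSum (convolution c d) ⟶ W) →
    partialSum a ⟶ X → partialSum b ⟶ Y → partialSum (convolution a b) ⟶ Z → X * Y ≡ Z
  cauchy-product {a} {b} {c} {d} {X} {Y} {Z} |a|≤c |b|≤d (U , c⟶U) (V , d⟶V) (W , cd⟶W) a⟶X b⟶Y ab⟶Z =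
    begin-equality
      X * Y         ≡⟨ solve 2 (λ x z → x := x :- z :+ z) refl (X * Y) Z ⟩
      -- The remainders tend to X Y - Z by the limit laws and to 0 by domination, so the two limits
      -- agree.
      X * Y - Z + Z ≡⟨ cong (λ x → x + Z) (lim-unique {remainder a b}
                         (lim-+ {λ m → partialSum a m * partialSum b m}
                           (lim-* a⟶X b⟶Y)
                           (lim-neg {triangle a b} (lim-cong (partialSum-convolution a b) ab⟶Z)))
                         (null-cong (λ m → sym (x-0≡x (remainder a b m)))
                           (null-squeeze (abs-remainder |a|≤c |b|≤d) remainder⟶0))) ⟩
      0# + Z        ≡⟨ +-identityˡ Z ⟩
      Z             ∎
    where
    x-0≡x : ∀ x → x - 0# ≡ x
    x-0≡x = solve 1 (λ x → x :- :0 := x) refl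

    0≤c : ∀ k → 0# ≤ c k
    0≤c k = ≤-trans (abs-nonneg _) (|a|≤c k)

    0≤d : ∀ k → 0# ≤ d k
    0≤d k = ≤-trans (abs-nonneg _) (|b|≤d k)

    triangle⟶W : triangle c d ⟶ W
    triangle⟶W = lim-cong (partialSum-convolution c d) cd⟶W

    UV≡W : U * V ≡ W
    UV≡W = ≤-antisym
      (lim-mono (0 , λ m _ → square≤triangle 0≤c 0≤d m m)
        (lim-* c⟶U d⟶V) (lim-subsequence {triangle c d} (λ m → m ℕ.+ m) (λ m → ℕ.m≤m+n m m) triangle⟶W))
      (lim-mono (0 , λ m _ → diff-≤ (remainder c d m)
          (≤-trans (abs-nonneg _) (abs-remainder |a|≤c |b|≤d m)) refl)
        triangle⟶W (lim-* c⟶U d⟶V))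

    remainder⟶0 : Null (remainder c d)
    remainder⟶0 = null-cong
      (λ m → trans (cong (λ x → remainder c d m - (x - W)) UV≡W)
        (solve 2 (λ r w → r :- (w :- w) := r) refl (remainder c d m) W))
      (lim-+ {λ m → partialSum c m * partialSum d m} (lim-* c⟶U d⟶V) (lim-neg {triangle c d} triangle⟶W))

  -- The exponential function

  -- The only gateway to `exp`, `log` and `sqrt`: each is used through its defining property after a
  -- witness has been constructed.
  the-spec : ∀ {X : Set} (d : X) {P : X → Set} → ∃ P → P (the d P)
  the-spec d {P} exists with em {∃ P}
  ... | yes (_ , Px) = Px
  ... | no  none     = ⊥-elim (none exists)

  expTerm : ℝ → ℕ → ℝ
  expTerm x k = x ^ k * fromℕ (k !) ⁻¹

  factorial-pos : ∀ k → 0# < fromℕ (k !)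
  factorial-pos zero    = fromℕ-suc-pos 0
  factorial-pos (suc k) = subst (λ x → 0# < x) (sym (fromℕ-* (suc k) (k !)))
    (*-pos _ _ (fromℕ-suc-pos k) (factorial-pos k))

  expTerm-zero : ∀ x → expTerm x 0 ≡ 1#
  expTerm-zero x = trans (*-identityˡ _)
    (sym (⁻¹-unique (fromℕ-suc-pos 0) (trans (*-identityʳ _) (+-identityʳ 1#))))

  -- The recurrence (k+1) t_{k+1} = x t_k, read as the formal equation u' = x u. The addition law
  -- and the termwise bounds on the exponential series all rest on it.
  derivative-expTerm : ∀ x k → derivative (expTerm x) k ≡ x * expTerm x k
  derivative-expTerm x k = begin-equality
    n * (x * x ^ k * g) ≡⟨ solve 4 (λ n x y g → n :* (x :* y :* g) := x :* (y :* (n :* g))) refl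
                             n x (x ^ k) g ⟩
    x * (x ^ k * (n * g)) ≡⟨ cong (λ y → x * (x ^ k * y)) (⁻¹-unique (factorial-pos k) (begin-equality
      fromℕ (k !) * (n * g)            ≡⟨ solve 3 (λ f n g → f :* (n :* g) := n :* f :* g) refl _ n g ⟩
      n * fromℕ (k !) * g              ≡⟨ cong (λ y → y * g) (sym (fromℕ-* (suc k) (k !))) ⟩
      fromℕ (suc k !) * g              ≡⟨ inverse-pos (factorial-pos (suc k)) ⟩
      1#                               ∎)) ⟩
    x * expTerm x k ∎
    where
    n = fromℕ (suc k)
    g = fromℕ (suc k !) ⁻¹

  expTerm-unique : ∀ x u → u 0 ≡ 1# → (∀ k → derivative u k ≡ x * u k) → ∀ k → u k ≡ expTerm x k
  expTerm-unique x u u₀≡1 u′≡xu zero    = trans u₀≡1 (sym (expTerm-zero x))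
  expTerm-unique x u u₀≡1 u′≡xu (suc k) = *-cancelˡ-≡ (fromℕ (suc k)) (fromℕ-suc-pos k) (begin-equality
    derivative u k            ≡⟨ u′≡xu k ⟩
    x * u k                   ≡⟨ cong (λ y → x * y) (expTerm-unique x u u₀≡1 u′≡xu k) ⟩
    x * expTerm x k           ≡⟨ sym (derivative-expTerm x k) ⟩
    derivative (expTerm x) k  ∎)

  -- The binomial theorem in disguise: by the product rule the convolution solves u' = (x + y) u
  -- with u₀ = 1, and such a solution is unique because k + 1 can be cancelled from the recurrence.
  convolution-expTerm : ∀ x y k → convolution (expTerm x) (expTerm y) k ≡ expTerm (x + y) k
  convolution-expTerm x y = expTerm-unique (x + y) (convolution (expTerm x) (expTerm y))
    (trans (cong₂ _*_ (expTerm-zero x) (expTerm-zero y)) (*-identityˡ 1#))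
    λ k → begin-equality
      derivative (convolution (expTerm x) (expTerm y)) k
        ≡⟨ leibniz (expTerm x) (expTerm y) k ⟩
      convolution (derivative (expTerm x)) (expTerm y) k + convolution (expTerm x) (derivative (expTerm y)) k
        ≡⟨ cong₂ _+_ (convolution-*ˡ x (expTerm y) (derivative-expTerm x) k)
                     (convolution-*ʳ (expTerm x) y (derivative-expTerm y) k) ⟩
      x * convolution (expTerm x) (expTerm y) k + y * convolution (expTerm x) (expTerm y) k
        ≡⟨ sym (distribʳ _ _ _) ⟩
      (x + y) * convolution (expTerm x) (expTerm y) k ∎

  ^-nonneg : ∀ {x} → 0# ≤ x → ∀ n → 0# ≤ x ^ n
  ^-nonneg 0≤x zero    = 0≤1
  ^-nonneg 0≤x (suc n) = *-nonneg 0≤x (^-nonneg 0≤x n)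

  expTerm-nonneg : ∀ {x} → 0# ≤ x → ∀ k → 0# ≤ expTerm x k
  expTerm-nonneg 0≤x k = *-nonneg (^-nonneg 0≤x k) (<⇒≤ (⁻¹-pos (factorial-pos k)))

  abs-^ : ∀ x n → abs (x ^ n) ≤ abs x ^ n
  abs-^ x zero    = inj₂ (0≤x⇒abs≡x 0≤1)
  abs-^ x (suc n) = ≤-trans (abs-* x (x ^ n)) (*-monoʳ-≤ (abs x) (abs-nonneg x) (abs-^ x n))

  abs-expTerm : ∀ x k → abs (expTerm x k) ≤ expTerm (abs x) k
  abs-expTerm x k = ≤-trans (abs-* (x ^ k) _) (*-mono-≤ (abs-nonneg _) (^-nonneg (abs-nonneg x) k)
    (abs-^ x k) (inj₂ (0≤x⇒abs≡x (<⇒≤ (⁻¹-pos (factorial-pos k))))))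

  -- From index 2x on, each term is at most half of its predecessor, hence
  -- bounded by 2 t_k - 2 t_{k+1}.
  expTerm-bounded : ∀ {x} → 0# ≤ x → BoundedSeries (expTerm x)
  expTerm-bounded {x} 0≤x with archimedean (x + x)
  ... | N , 2x≤N = bounded-drop N (expTerm-nonneg 0≤x)
    (bounded-telescope _ (λ j → t (N ℕ.+ j) + t (N ℕ.+ j))
      (λ j → +-nonneg (expTerm-nonneg 0≤x (N ℕ.+ j)) (expTerm-nonneg 0≤x (N ℕ.+ j))) λ j →
      subst (λ k → t (N ℕ.+ j) ≤ t (N ℕ.+ j) + t (N ℕ.+ j) - (t k + t k)) (sym (ℕ.+-suc N j))
        (decrease (N ℕ.+ j) (ℕ.m≤m+n N j)))
    where
    t = expTerm x

    2t≤t : ∀ k → N ℕ.≤ k → t (suc k) + t (suc k) ≤ t k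
    2t≤t k N≤k = *-cancelˡ-≤ (fromℕ (suc k)) (fromℕ-suc-pos k) (begin
      fromℕ (suc k) * (t (suc k) + t (suc k))
        ≡⟨ distribˡ _ _ _ ⟩
      derivative t k + derivative t k
        ≡⟨ cong₂ _+_ (derivative-expTerm x k) (derivative-expTerm x k) ⟩
      x * t k + x * t k
        ≡⟨ sym (distribʳ _ _ _) ⟩
      (x + x) * t k
        ≤⟨ *-monoˡ-≤ (t k) (expTerm-nonneg 0≤x k) (≤-trans 2x≤N
             (increasing {fromℕ} (x≤1+x ∘ fromℕ) (ℕ.m≤n⇒m≤1+n N≤k))) ⟩
      fromℕ (suc k) * t k ∎)

    decrease : ∀ k → N ℕ.≤ k → t k ≤ t k + t k - (t (suc k) + t (suc k))
    decrease k N≤k = diff-≤ (t k - (t (suc k) + t (suc k))) (≤⇒0≤ (2t≤t k N≤k))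
      (solve 2 (λ t u → t :+ t :- u :- t := t :- u) refl (t k) (t (suc k) + t (suc k)))

  exp-limit : ∀ x → partialSum (expTerm x) ⟶ exp x
  exp-limit x = SumsTo⇒⟶ {expTerm x} (the-spec 0# {SumsTo (expTerm x)}
    (let L , s⟶L = absolute-convergence (expTerm x) (expTerm (abs x)) (abs-expTerm x)
                     (expTerm-bounded (abs-nonneg x))
     in  L , ⟶⇒SumsTo {expTerm x} s⟶L))

  -- The majorants are the exponential series of |x| and |y|, so `convolution-expTerm` also supplies
  -- the convergence of their Cauchy product.
  exp-+ : ∀ x y → exp x * exp y ≡ exp (x + y)
  exp-+ x y = cauchy-product {expTerm x} {expTerm y} (abs-expTerm x) (abs-expTerm y)
    (_ , exp-limit (abs x)) (_ , exp-limit (abs y)) (_ , product-limit (abs x) (abs y))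
    (exp-limit x) (exp-limit y) (product-limit x y)
    where
    product-limit : ∀ x y → partialSum (convolution (expTerm x) (expTerm y)) ⟶ exp (x + y)
    product-limit x y =
      lim-cong (partialSum-cong (sym ∘ convolution-expTerm x y)) (exp-limit (x + y))

  exp-0 : exp 0# ≡ 1#
  exp-0 = sym (lim-unique {partialSum (expTerm 0#)}
    -- The empty partial sum is 0; the sums equal 1 only from length one on, hence the shift.
    (lim-shift (lim-cong sums≡1 (lim-const 1#))) (exp-limit 0#))
    where
    zeros : ∀ m → partialSum (expTerm 0# ∘ suc) m ≡ 0#
    zeros m = trans (partialSum-cong (λ k → *-assoc 0# (0# ^ k) _) m)
      (trans (partialSum-*ˡ 0# (λ k → 0# ^ k * fromℕ (suc k !) ⁻¹) m) (zeroˡ _))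

    sums≡1 : ∀ m → 1# ≡ partialSum (expTerm 0#) (suc m)
    sums≡1 m = sym (trans (cong₂ _+_ (expTerm-zero 0#) (zeros m)) (+-identityʳ 1#))

  exp-inverse : ∀ x → exp x * exp (- x) ≡ 1#
  exp-inverse x = trans (exp-+ x (- x)) (trans (cong exp (-‿inverseʳ x)) exp-0)

  -- Bounds and monotonicity of the exponential

  exp-lower-nonneg : ∀ {x} → 0# ≤ x → 1# + x ≤ exp x
  -- 1 + x is the partial sum of length 2, and the later ones only add nonnegative terms.
  exp-lower-nonneg {x} 0≤x = lim-mono (2 , λ m 2≤m → begin
      1# + x                      ≡⟨ cong (λ y → y + x) (sym (expTerm-zero x)) ⟩
      expTerm x 0 + x             ≡⟨ cong (λ y → expTerm x 0 + y)
                                       (trans (first-term x) (sym (+-identityʳ _))) ⟩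
      partialSum (expTerm x) 2    ≤⟨ increasing (partialSum-step (expTerm-nonneg 0≤x)) 2≤m ⟩
      partialSum (expTerm x) m    ∎)
    (lim-const (1# + x)) (exp-limit x)
    where
    first-term : ∀ x → x ≡ expTerm x 1
    first-term x = begin-equality
      x                              ≡⟨ sym (*-identityʳ x) ⟩
      x * 1#                         ≡⟨ cong (λ y → x * y) (sym (expTerm-zero x)) ⟩
      x * expTerm x 0                ≡⟨ sym (derivative-expTerm x 0) ⟩
      fromℕ 1 * expTerm x 1          ≡⟨ solve 1 (λ t → (:1 :+ :0) :* t := t) refl (expTerm x 1) ⟩
      expTerm x 1                    ∎

  exp-pos-nonneg : ∀ {x} → 0# ≤ x → 0# < exp x
  exp-pos-nonneg {x} 0≤x = begin-strict
    0#      <⟨ 0<1 ⟩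
    1#      ≡⟨ sym (+-identityʳ 1#) ⟩
    1# + 0# ≤⟨ +-mono-≤ ≤-refl 0≤x ⟩
    1# + x  ≤⟨ exp-lower-nonneg 0≤x ⟩
    exp x   ∎

  -- Termwise t_{k+1} ≤ x t_k, so exp x - 1 ≤ x exp x.
  exp-upper : ∀ {x} → 0# ≤ x → (1# - x) * exp x ≤ 1#
  exp-upper {x} 0≤x = diff-≤ (1# + x * exp x - exp x)
    (≤⇒0≤ (lim-mono (0 , λ m _ → bound m)
      (lim-subsequence {partialSum (expTerm x)} suc ℕ.n≤1+n (exp-limit x))
      (lim-+ {λ _ → 1#} {λ m → x * partialSum (expTerm x) m}
        (lim-const 1#) (lim-* (lim-const x) (exp-limit x)))))
    (solve 2 (λ x e → :1 :- (:1 :- x) :* e := :1 :+ x :* e :- e) refl x (exp x))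
    where
    term : ∀ k → expTerm x (suc k) ≤ x * expTerm x k
    term k = begin
      expTerm x (suc k)                ≡⟨ sym (+-identityʳ _) ⟩
      expTerm x (suc k) + 0#
        ≤⟨ +-mono-≤ ≤-refl (*-nonneg (fromℕ-nonneg k) (expTerm-nonneg 0≤x (suc k))) ⟩
      expTerm x (suc k) + fromℕ k * expTerm x (suc k)
        ≡⟨ solve 2 (λ t k → t :+ k :* t := (:1 :+ k) :* t) refl (expTerm x (suc k)) (fromℕ k) ⟩
      fromℕ (suc k) * expTerm x (suc k) ≡⟨ derivative-expTerm x k ⟩
      x * expTerm x k                  ∎

    bound : ∀ m → partialSum (expTerm x) (suc m) ≤ 1# + x * partialSum (expTerm x) m
    bound m = +-mono-≤ (inj₂ (expTerm-zero x)) (begin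
      partialSum (expTerm x ∘ suc) m       ≤⟨ partialSum-mono term m ⟩
      partialSum (λ k → x * expTerm x k) m ≡⟨ partialSum-*ˡ x (expTerm x) m ⟩
      x * partialSum (expTerm x) m         ∎)

  -- For negative x, `exp-upper` at -x reads (1 + x) exp(-x) ≤ 1 = exp x exp(-x), and exp(-x)
  -- cancels.
  exp-lower : ∀ x → 1# + x ≤ exp x
  exp-lower x with ≤-total 0# x
  ... | inj₁ 0≤x = exp-lower-nonneg 0≤x
  ... | inj₂ x≤0 = *-cancelˡ-≤ (exp (- x)) (exp-pos-nonneg 0≤-x) (begin
    exp (- x) * (1# + x)      ≡⟨ solve 2 (λ e x → e :* (:1 :+ x) := (:1 :- :- x) :* e) refl (exp (- x)) x ⟩
    (1# - - x) * exp (- x)    ≤⟨ exp-upper 0≤-x ⟩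
    1#                        ≡⟨ sym (exp-inverse x) ⟩
    exp x * exp (- x)         ≡⟨ *-comm _ _ ⟩
    exp (- x) * exp x         ∎)
    where
    0≤-x = x≤0⇒0≤-x x≤0

  exp-pos : ∀ x → 0# < exp x
  exp-pos x with ≤-total 0# x
  ... | inj₁ 0≤x = exp-pos-nonneg 0≤x
  ... | inj₂ x≤0 = ≰⇒> λ e≤0 → <⇒≱ 0<1 (begin
    1#                 ≡⟨ sym (exp-inverse x) ⟩
    exp x * exp (- x)  ≤⟨ *-monoˡ-≤ (exp (- x)) (<⇒≤ (exp-pos-nonneg 0≤-x)) e≤0 ⟩
    0# * exp (- x)     ≡⟨ zeroˡ _ ⟩
    0#                 ∎)
    where
    0≤-x = x≤0⇒0≤-x x≤0

  -- The graph lies above its tangent at x: multiply exp(y - x) ≥ 1 + (y - x) by exp x. It holds for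
  -- either order of x and y, and both are used.
  exp-growth : ∀ x y → exp x * (y - x) ≤ exp y - exp x
  exp-growth x y = begin
    exp x * (y - x)
      ≡⟨ solve 3 (λ e x y → e :* (y :- x) := e :* (:1 :+ (y :- x)) :- e) refl (exp x) x y ⟩
    exp x * (1# + (y - x)) - exp x
      ≤⟨ +-monoˡ-≤ (- exp x) (*-monoʳ-≤ (exp x) (<⇒≤ (exp-pos x)) (exp-lower (y - x))) ⟩
    exp x * exp (y - x) - exp x
      ≡⟨ cong (λ z → z - exp x) (trans (exp-+ x (y - x))
           (cong exp (solve 2 (λ x y → x :+ (y :- x) := y) refl x y))) ⟩
    exp y - exp x               ∎

  exp-mono-< : ∀ {x y} → x < y → exp x < exp y
  exp-mono-< {x} {y} x<y = diff-< (exp y - exp x) (begin-strict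
    0#              <⟨ *-pos _ _ (exp-pos x) (<⇒0< x<y) ⟩
    exp x * (y - x) ≤⟨ exp-growth x y ⟩
    exp y - exp x   ∎) refl

  exp-mono-≤ : ∀ {x y} → x ≤ y → exp x ≤ exp y
  exp-mono-≤ (inj₁ x<y)  = inj₁ (exp-mono-< x<y)
  exp-mono-≤ (inj₂ refl) = ≤-refl

  exp-cancel-≤ : ∀ {x y} → exp x ≤ exp y → x ≤ y
  exp-cancel-≤ ex≤ey = ≮⇒≥ λ y<x → <⇒≱ (exp-mono-< y<x) ex≤ey

  -- At the supremum s of { y | exp y ≤ x }, the bound exp (-h) ≥ 1 - h with
  -- the h for which 1 - h is the ratio of exp s and x excludes both strict
  -- inequalities.
  exp-surjective : ∀ {x} → 0# < x → ∃[ y ] exp y ≡ x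
  exp-surjective {x} 0<x = root (supremum (λ y → exp y ≤ x)
    -- The set contains -1/x because exp(1/x) ≥ 1/x, and x bounds it because y ≤ exp y.
    (- (x ⁻¹) , *-cancelˡ-≤ (x ⁻¹) (⁻¹-pos 0<x) (begin
      x ⁻¹ * exp (- (x ⁻¹))
        ≤⟨ *-monoˡ-≤ _ (<⇒≤ (exp-pos _)) (≤-trans (x≤1+x (x ⁻¹)) (exp-lower (x ⁻¹))) ⟩
      exp (x ⁻¹) * exp (- (x ⁻¹))
        ≡⟨ exp-inverse (x ⁻¹) ⟩
      1#                           ≡⟨ sym (inverse-pos 0<x) ⟩
      x * x ⁻¹                     ≡⟨ *-comm _ _ ⟩
      x ⁻¹ * x                     ∎))
    (x , λ y ey≤x → ≤-trans (x≤1+x y) (≤-trans (exp-lower y) ey≤x)))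
    where
    root : (∃[ s ] UpperBound (λ y → exp y ≤ x) s × (∀ b → UpperBound (λ y → exp y ≤ x) b → s ≤ b)) →
           ∃[ y ] exp y ≡ x
    root (s , s-upper , s-least) = s , ≤-antisym (≮⇒≥ above) (≮⇒≥ below)
      where
      below : ¬ exp s < x
      below es<x = <⇒≱ 0<h (diff-≤ (s - (s + h)) (≤⇒0≤ (s-upper (s + h) es+h≤x))
          (solve 2 (λ s h → :0 :- h := s :- (s :+ h)) refl s h))
        where
        h = x ⁻¹ * (x - exp s)

        0<h : 0# < h
        0<h = *-pos _ _ (⁻¹-pos 0<x) (<⇒0< es<x)

        x[1-h]≡es : x * (1# - h) ≡ exp s
        x[1-h]≡es = begin-equality
          x * (1# - x ⁻¹ * (x - exp s))
            ≡⟨ solve 3 (λ x i e → x :* (:1 :- i :* (x :- e)) := x :- (x :* i) :* (x :- e)) refl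
                 x (x ⁻¹) (exp s) ⟩
          x - (x * x ⁻¹) * (x - exp s)
            ≡⟨ cong (λ y → x - y * (x - exp s)) (inverse-pos 0<x) ⟩
          x - 1# * (x - exp s)
            ≡⟨ solve 2 (λ x e → x :- :1 :* (x :- e) := e) refl x (exp s) ⟩
          exp s                           ∎

        es+h≤x : exp (s + h) ≤ x
        es+h≤x = *-cancelˡ-≤ (exp (- h)) (exp-pos (- h)) (begin
          exp (- h) * exp (s + h) ≡⟨ trans (exp-+ _ _)
                                       (cong exp (solve 2 (λ s h → :- h :+ (s :+ h) := s) refl s h)) ⟩
          exp s                   ≡⟨ sym x[1-h]≡es ⟩
          x * (1# - h)            ≤⟨ *-monoʳ-≤ x (<⇒≤ 0<x) (exp-lower (- h)) ⟩
          x * exp (- h)           ≡⟨ *-comm _ _ ⟩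
          exp (- h) * x           ∎)

      above : ¬ x < exp s
      above x<es = <⇒≱ 0<h (diff-≤ (s - h - s) (≤⇒0≤ (s-least (s - h) λ y ey≤x →
          exp-cancel-≤ (≤-trans ey≤x x≤es-h)))
          (solve 2 (λ s h → :0 :- h := s :- h :- s) refl s h))
        where
        h = exp s ⁻¹ * (exp s - x)

        0<h : 0# < h
        0<h = *-pos _ _ (⁻¹-pos (exp-pos s)) (<⇒0< x<es)

        x≤es-h : x ≤ exp (s - h)
        x≤es-h = begin
          x ≡⟨ solve 2 (λ x e → x := e :- :1 :* (e :- x)) refl x (exp s) ⟩
          exp s - 1# * (exp s - x)
            ≡⟨ cong (λ y → exp s - y * (exp s - x)) (sym (inverse-pos (exp-pos s))) ⟩
          exp s - exp s * exp s ⁻¹ * (exp s - x)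
            ≡⟨ solve 3 (λ x i e → e :- e :* i :* (e :- x) := e :* (:1 :- i :* (e :- x))) refl
                 x (exp s ⁻¹) (exp s) ⟩
          exp s * (1# - h)   ≤⟨ *-monoʳ-≤ (exp s) (<⇒≤ (exp-pos s)) (exp-lower (- h)) ⟩
          exp s * exp (- h)  ≡⟨ exp-+ s (- h) ⟩
          exp (s - h)        ∎

  -- Logarithms and square roots

  exp-log : ∀ {x} → 0# < x → exp (log x) ≡ x
  exp-log {x} 0<x = the-spec 0# {λ y → exp y ≡ x} (exp-surjective 0<x)

  sqrt-spec : ∀ {x} → 0# ≤ x → 0# ≤ sqrt x × sqrt x * sqrt x ≡ x
  sqrt-spec {x} 0≤x = the-spec 0# {λ y → 0# ≤ y × y * y ≡ x} (root 0≤x)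
    where
    root : ∀ {x} → 0# ≤ x → ∃[ y ] 0# ≤ y × y * y ≡ x
    root (inj₂ refl) = 0# , ≤-refl , zeroˡ 0#
    root {x} (inj₁ 0<x) = exp (half * log x) , <⇒≤ (exp-pos _) ,
      trans (exp-+ _ _) (trans (cong exp (half+half (log x))) (exp-log 0<x))

  -- Complex numbers

  -- Squared norms are polynomial in the coordinates, so the ring solver applies to them;
  -- `norm-square` converts to and from norms at the two ends of the estimate.
  normSq : ℂ → ℝ
  normSq z = re z * re z + im z * im z

  normSq-nonneg : ∀ z → 0# ≤ normSq z
  normSq-nonneg z = +-nonneg (square-nonneg (re z)) (square-nonneg (im z))

  norm-nonneg : ∀ z → 0# ≤ ∥ z ∥
  norm-nonneg z = proj₁ (sqrt-spec (normSq-nonneg z))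

  norm-square : ∀ z → ∥ z ∥ * ∥ z ∥ ≡ normSq z
  norm-square z = proj₂ (sqrt-spec (normSq-nonneg z))

  normSq-* : ∀ z w → normSq (z *ᶜ w) ≡ normSq z * normSq w
  normSq-* z w = solve 4 (λ a b c d →
    (a :* c :- b :* d) :* (a :* c :- b :* d) :+ (a :* d :+ b :* c) :* (a :* d :+ b :* c)
      := (a :* a :+ b :* b) :* (c :* c :+ d :* d)) refl (re z) (im z) (re w) (im w)

  normSq-^ : ∀ z n → normSq (z ^ᶜ n) ≡ normSq z ^ n
  normSq-^ z zero    = solve 0 (:1 :* :1 :+ :0 :* :0 := :1) refl
  normSq-^ z (suc n) = trans (normSq-* z (z ^ᶜ n)) (cong (λ x → normSq z * x) (normSq-^ z n))

  -- By the parallelogram law.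
  normSq-+ : ∀ z w → normSq (z +ᶜ w) ≤ fromℕ 2 * (normSq z + normSq w)
  normSq-+ z w = diff-≤ (normSq (z -ᶜ w)) (normSq-nonneg (z -ᶜ w))
    (solve 4 (λ a b c d →
      con (+ 2) :* ((a :* a :+ b :* b) :+ (c :* c :+ d :* d))
        :- ((a :+ c) :* (a :+ c) :+ (b :+ d) :* (b :+ d))
        := (a :- c) :* (a :- c) :+ (b :- d) :* (b :- d)) refl (re z) (im z) (re w) (im w))

  -- K is fixed before B and the summands, so a single constant serves all primes and exponents.
  -- Iterating the two-term bound gives K = 2^{n+1} - 2.
  normSq-sum : ∀ n → ∃[ K ] 0# ≤ K × (∀ B (z : Fin n → ℂ) → (∀ i → normSq (z i) ≤ B) →
               normSq (sumᶜ z) ≤ K * B)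
  normSq-sum zero    = 0# , ≤-refl , λ B z _ →
    inj₂ (solve 1 (λ B → :0 :* :0 :+ :0 :* :0 := :0 :* B) refl B)
  normSq-sum (suc n) =
    let K , 0≤K , bound = normSq-sum n
    in  fromℕ 2 * (1# + K) , *-nonneg (fromℕ-nonneg 2) (+-nonneg 0≤1 0≤K) , λ B z z≤B → begin
          normSq (z zero +ᶜ sumᶜ (z ∘ suc))
            ≤⟨ normSq-+ (z zero) (sumᶜ (z ∘ suc)) ⟩
          fromℕ 2 * (normSq (z zero) + normSq (sumᶜ (z ∘ suc)))
            ≤⟨ *-monoʳ-≤ (fromℕ 2) (fromℕ-nonneg 2) (+-mono-≤ (z≤B zero) (bound B (z ∘ suc) (z≤B ∘ suc))) ⟩
          fromℕ 2 * (B + K * B)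
            ≡⟨ solve 2 (λ B K → con (+ 2) :* (B :+ K :* B) := con (+ 2) :* (:1 :+ K) :* B) refl B K ⟩
          fromℕ 2 * (1# + K) * B ∎

  -- The series over primes

  ^-mono-≤ : ∀ {x y} → 0# ≤ x → x ≤ y → ∀ n → x ^ n ≤ y ^ n
  ^-mono-≤ 0≤x x≤y zero    = ≤-refl
  ^-mono-≤ 0≤x x≤y (suc n) =
    *-mono-≤ (^-nonneg 0≤x n) (≤-trans 0≤x x≤y) x≤y (^-mono-≤ 0≤x x≤y n)

  ^-pos : ∀ {x} → 0# < x → ∀ n → 0# < x ^ n
  ^-pos 0<x zero    = 0<1
  ^-pos 0<x (suc n) = *-pos _ _ 0<x (^-pos 0<x n)

  1^n≡1 : ∀ n → 1# ^ n ≡ 1#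
  1^n≡1 zero    = refl
  1^n≡1 (suc n) = trans (*-identityˡ _) (1^n≡1 n)

  ^-antitone : ∀ {x} → 0# ≤ x → x ≤ 1# → ∀ m n → x ^ (m ℕ.+ n) ≤ x ^ m
  ^-antitone {x} 0≤x x≤1 zero    n = subst (λ y → x ^ n ≤ y) (1^n≡1 n) (^-mono-≤ 0≤x x≤1 n)
  ^-antitone {x} 0≤x x≤1 (suc m) n = *-monoʳ-≤ x 0≤x (^-antitone 0≤x x≤1 m n)

  quarter : ℝ
  quarter = fromℕ 4 ⁻¹

  -- The solver treats `quarter` as a variable, so the relation 4 · (1/4) = 1 is brought in
  -- explicitly.
  x≡4*quarter*x : ∀ x → x ≡ fromℕ 4 * quarter * x
  x≡4*quarter*x x =
    sym (trans (cong (λ y → y * x) (inverse-pos (fromℕ-suc-pos 3))) (*-identityˡ x))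

  -- Here L = log p.  With q = p^{2(1/4-ε)-1}, the left side is q^r L²; it is
  -- at most (q L)² as q ≤ 1, and ε L ≤ p^ε.
  prime-power-bound : ∀ {ε L} → 0# < ε → 0# ≤ L → ∀ {r} → 2 ℕ.≤ r →
    let b = exp ((quarter - ε) * L) in
    (b * b) ^ r * L ^ 2 * exp (- L) ^ r ≤ ε ⁻¹ * ε ⁻¹ * (exp (- L) * exp (- ((ε + ε) * L)))
  prime-power-bound {ε} {L} 0<ε 0≤L {suc (suc s)} (s≤s (s≤s z≤n)) = begin
    (b * b) ^ r * L ^ 2 * g ^ r
      ≡⟨ solve 3 (λ x y z → x :* y :* z := x :* z :* y) refl ((b * b) ^ r) (L ^ 2) (g ^ r) ⟩
    (b * b) ^ r * g ^ r * L ^ 2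
      ≡⟨ cong (λ x → x * L ^ 2) (sym (^-distrib-* (b * b) g r)) ⟩
    q ^ r * L ^ 2
      -- Reduction to the critical exponent 2: matching on 2 ≤ r has written r as 2 + s, and q ≤ 1.
      ≤⟨ *-monoˡ-≤ (L ^ 2) (^-nonneg 0≤L 2) (^-antitone 0≤q q≤1 2 s) ⟩
    q ^ 2 * L ^ 2
      ≡⟨ sym (*-identityˡ _) ⟩
    1# * (q ^ 2 * L ^ 2)
      -- The factor (ε ε⁻¹)² hands an ε to each L, which then falls under ε L ≤ exp(ε L).
      ≡⟨ cong (λ x → x * (q ^ 2 * L ^ 2))
           (sym (trans (cong₂ _*_ (inverse-pos 0<ε) (inverse-pos 0<ε)) (*-identityˡ 1#))) ⟩
    (ε * ε ⁻¹) * (ε * ε ⁻¹) * (q ^ 2 * L ^ 2)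
      ≡⟨ solve 4 (λ e i q l → (e :* i) :* (e :* i) :* (q :* (q :* :1) :* (l :* (l :* :1)))
           := i :* i :* ((e :* l :* q) :* (e :* l :* q))) refl ε (ε ⁻¹) q L ⟩
    ε ⁻¹ * ε ⁻¹ * ((ε * L * q) * (ε * L * q))
      ≤⟨ *-monoʳ-≤ _ (*-nonneg (<⇒≤ (⁻¹-pos 0<ε)) (<⇒≤ (⁻¹-pos 0<ε)))
           (*-mono-≤ 0≤εLq (<⇒≤ (exp-pos h)) εLq≤eh εLq≤eh) ⟩
    ε ⁻¹ * ε ⁻¹ * (exp h * exp h)
      ≡⟨ cong (λ x → ε ⁻¹ * ε ⁻¹ * x) (trans (exp-+ h h) (trans (cong exp 2h) (sym (exp-+ _ _)))) ⟩
    ε ⁻¹ * ε ⁻¹ * (exp (- L) * exp (- ((ε + ε) * L))) ∎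
    where
    r = 2 ℕ.+ s
    t = (quarter - ε) * L
    b = exp t
    g = exp (- L)
    q = b * b * g
    h = ε * L + (t + t - L)

    q≡exp : q ≡ exp (t + t - L)
    q≡exp = trans (cong (λ x → x * g) (exp-+ t t)) (exp-+ (t + t) (- L))

    0≤q : 0# ≤ q
    0≤q = subst (λ x → 0# ≤ x) (sym q≡exp) (<⇒≤ (exp-pos _))

    0≤quarter : 0# ≤ quarter
    0≤quarter = <⇒≤ (⁻¹-pos (fromℕ-suc-pos 3))

    exponent≤0 : t + t - L ≤ 0#
    exponent≤0 = diff-≤ ((ε + ε + (quarter + quarter)) * L)
      (*-nonneg (+-nonneg (+-nonneg (<⇒≤ 0<ε) (<⇒≤ 0<ε)) (+-nonneg 0≤quarter 0≤quarter)) 0≤L)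
      (trans (cong (λ x → 0# - (t + t - x)) (x≡4*quarter*x L))
        (solve 3 (λ c e l → :0 :- ((c :- e) :* l :+ (c :- e) :* l :- con (+ 4) :* c :* l)
            := (e :+ e :+ (c :+ c)) :* l) refl quarter ε L))

    q≤1 : q ≤ 1#
    q≤1 = subst₂ _≤_ (sym q≡exp) exp-0 (exp-mono-≤ exponent≤0)

    0≤εL : 0# ≤ ε * L
    0≤εL = *-nonneg (<⇒≤ 0<ε) 0≤L

    0≤εLq : 0# ≤ ε * L * q
    0≤εLq = *-nonneg 0≤εL 0≤q

    εLq≤eh : ε * L * q ≤ exp h
    εLq≤eh = begin
      ε * L * q                     ≤⟨ *-monoˡ-≤ q 0≤q (x≤1+x (ε * L)) ⟩
      (1# + ε * L) * q              ≤⟨ *-monoˡ-≤ q 0≤q (exp-lower (ε * L)) ⟩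
      exp (ε * L) * q               ≡⟨ cong (λ x → exp (ε * L) * x) q≡exp ⟩
      exp (ε * L) * exp (t + t - L) ≡⟨ exp-+ _ _ ⟩
      exp h                         ∎

    2h : h + h ≡ - L + - ((ε + ε) * L)
    2h = begin-equality
      h + h ≡⟨ solve 3 (λ c e l →
                 let x = e :* l :+ ((c :- e) :* l :+ (c :- e) :* l :- l) in
                 x :+ x := con (+ 4) :* c :* l :- (l :+ l) :- (e :+ e) :* l) refl quarter ε L ⟩
      fromℕ 4 * quarter * L - (L + L) - (ε + ε) * L
            ≡⟨ cong (λ x → x - (L + L) - (ε + ε) * L) (sym (x≡4*quarter*x L)) ⟩
      L - (L + L) - (ε + ε) * L
            ≡⟨ solve 2 (λ l x → l :- (l :+ l) :- x := :- l :+ :- x) refl L ((ε + ε) * L) ⟩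
      - L + - ((ε + ε) * L) ∎

  -- For L = log m and M = log (m + 1) this is δ (m+1)^{-1-δ} ≤ m^{-δ} - (m+1)^{-δ}.
  power-telescope : ∀ {δ L M} → 0# ≤ δ → exp M ≡ 1# + exp L →
    δ * (exp (- M) * exp (- (δ * M))) ≤ exp (- (δ * L)) - exp (- (δ * M))
  power-telescope {δ} {L} {M} 0≤δ eM≡1+eL = begin
    δ * (exp (- M) * exp (- (δ * M)))
      ≤⟨ *-monoʳ-≤ δ 0≤δ (*-monoˡ-≤ _ (<⇒≤ (exp-pos _)) e-M≤M-L) ⟩
    δ * ((M - L) * exp (- (δ * M)))
      ≡⟨ solve 4 (λ d l m e → d :* ((m :- l) :* e) := e :* (:- (d :* l) :- :- (d :* m))) refl
           δ L M (exp (- (δ * M))) ⟩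
    exp (- (δ * M)) * (- (δ * L) - - (δ * M))
      -- The tangent is taken at the endpoint -δM, where the exponential is smaller.
      ≤⟨ exp-growth (- (δ * M)) (- (δ * L)) ⟩
    exp (- (δ * L)) - exp (- (δ * M)) ∎
    where
    -- This is 1/(m+1) ≤ log(m+1) - log m, from the tangent at M evaluated at L, where exp L - exp M
    -- = -1.
    e-M≤M-L : exp (- M) ≤ M - L
    e-M≤M-L = *-cancelˡ-≤ (exp M) (exp-pos M) (begin
      exp M * exp (- M)    ≡⟨ exp-inverse M ⟩
      1#                   ≡⟨ solve 1 (λ e → :1 := :- (e :- (:1 :+ e))) refl (exp L) ⟩
      - (exp L - (1# + exp L)) ≡⟨ cong (λ x → - (exp L - x)) (sym eM≡1+eL) ⟩
      - (exp L - exp M)    ≤⟨ neg-≤ (exp-growth M L) ⟩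
      - (exp M * (L - M))  ≡⟨ solve 3 (λ e l m → :- (e :* (l :- m)) := e :* (m :- l)) refl (exp M) L M ⟩
      exp M * (M - L)      ∎)

  log-nonneg : ∀ n → 0# ≤ log (fromℕ (suc n))
  log-nonneg n = exp-cancel-≤ (begin
    exp 0#                     ≡⟨ exp-0 ⟩
    1#                         ≡⟨ sym (+-identityʳ 1#) ⟩
    1# + 0#                    ≤⟨ +-mono-≤ ≤-refl (fromℕ-nonneg n) ⟩
    fromℕ (suc n)              ≡⟨ sym (exp-log (fromℕ-suc-pos n)) ⟩
    exp (log (fromℕ (suc n)))  ∎)

  module _ {n : ℕ} (α : ℕ → Fin n → ℂ) where

    -- Unfolds to the same sum as `a[ α ] p r`, so the final bound has the shape of `RudnickSarnak`
    -- without any transport.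
    powerSum : ℕ → ℕ → ℂ
    powerSum p r = sumᶜ λ i → α p i ^ᶜ r

    term : ℕ → ℕ → ℝ
    term r p = ∥ powerSum p r ∥ ^ 2 * log (fromℕ p) ^ 2 * (fromℕ p ^ r) ⁻¹

    -- Stated at `suc p` to keep the base positive: the sign of an inverse is known only for
    -- positive arguments.
    term-nonneg : ∀ r p → 0# ≤ term r (suc p)
    term-nonneg r p = *-nonneg
      (*-nonneg (^-nonneg (norm-nonneg _) 2) (^-nonneg (log-nonneg p) 2))
      (<⇒≤ (⁻¹-pos (^-pos (fromℕ-suc-pos p) r)))

    term-bound : ∀ {ε} → 0# < ε → ∃[ K ] 0# ≤ K × (∀ {r} → 2 ℕ.≤ r → ∀ p →
      (∀ i → ∥ α (suc p) i ∥ ≤ fromℕ (suc p) ^ʳ (quarter - ε)) →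
      let L = log (fromℕ (suc p)) in term r (suc p) ≤ K * (exp (- L) * exp (- ((ε + ε) * L))))
    term-bound {ε} 0<ε =
      let K , 0≤K , sum-bound = normSq-sum n
      in  K * (ε ⁻¹ * ε ⁻¹) , *-nonneg 0≤K (*-nonneg (<⇒≤ (⁻¹-pos 0<ε)) (<⇒≤ (⁻¹-pos 0<ε))) ,
          λ {r} 2≤r p α≤ →
            let x = fromℕ (suc p)
                L = log x
                b = exp ((quarter - ε) * L)
                g = exp (- L)
                S = powerSum (suc p) r
                α^r≤ : ∀ i → normSq (α (suc p) i ^ᶜ r) ≤ (b * b) ^ r
                α^r≤ i = begin
                  normSq (α (suc p) i ^ᶜ r) ≡⟨ normSq-^ (α (suc p) i) r ⟩
                  normSq (α (suc p) i) ^ r  ≤⟨ ^-mono-≤ (normSq-nonneg _) (begin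
                    normSq (α (suc p) i)               ≡⟨ sym (norm-square _) ⟩
                    ∥ α (suc p) i ∥ * ∥ α (suc p) i ∥
                      ≤⟨ *-mono-≤ (norm-nonneg _) (<⇒≤ (exp-pos _)) (α≤ i) (α≤ i) ⟩
                    b * b ∎) r ⟩
                  (b * b) ^ r ∎
                x^r-inverse : (x ^ r) ⁻¹ ≡ g ^ r
                x^r-inverse = sym (⁻¹-unique (^-pos (fromℕ-suc-pos p) r) (begin-equality
                  x ^ r * g ^ r     ≡⟨ sym (^-distrib-* x g r) ⟩
                  (x * g) ^ r       ≡⟨ cong (λ y → (y * g) ^ r) (sym (exp-log (fromℕ-suc-pos p))) ⟩
                  (exp L * g) ^ r   ≡⟨ cong (λ y → y ^ r) (exp-inverse L) ⟩
                  1# ^ r            ≡⟨ 1^n≡1 r ⟩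
                  1#                ∎))
            in  begin
              ∥ S ∥ ^ 2 * L ^ 2 * (x ^ r) ⁻¹
                ≡⟨ cong₂ (λ y z → y * L ^ 2 * z)
                     (trans (cong (λ y → ∥ S ∥ * y) (*-identityʳ _)) (norm-square S)) x^r-inverse ⟩
              normSq S * L ^ 2 * g ^ r
                ≤⟨ *-monoˡ-≤ (g ^ r) (^-nonneg (<⇒≤ (exp-pos (- L))) r)
                     (*-monoˡ-≤ (L ^ 2) (^-nonneg (log-nonneg p) 2)
                       (sum-bound ((b * b) ^ r) (λ i → α (suc p) i ^ᶜ r) α^r≤)) ⟩
              K * (b * b) ^ r * L ^ 2 * g ^ r
                ≡⟨ solve 4 (λ k y l z → k :* y :* l :* z := k :* (y :* l :* z)) refl
                     K ((b * b) ^ r) (L ^ 2) (g ^ r) ⟩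
              K * ((b * b) ^ r * L ^ 2 * g ^ r)
                ≤⟨ *-monoʳ-≤ K 0≤K (prime-power-bound 0<ε (log-nonneg p) 2≤r) ⟩
              K * (ε ⁻¹ * ε ⁻¹ * (g * exp (- ((ε + ε) * L))))
                ≡⟨ sym (*-assoc K _ _) ⟩
              K * (ε ⁻¹ * ε ⁻¹) * (g * exp (- ((ε + ε) * L))) ∎

    summable-over-primes : ∀ {ε} → 0# < ε →
      (∀ p → Prime p → ∀ i → ∥ α p i ∥ ≤ fromℕ p ^ʳ (quarter - ε)) →
      ∀ {r} → 2 ℕ.≤ r →
      Summable λ p → if does (prime? p) then term r p else 0#
    summable-over-primes {ε} 0<ε α≤ {r} 2≤r =
      let K , 0≤K , bound = term-bound 0<ε
          -- Bounding the term at m involves log(m - 1) of a positive integer, so the telescoping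
          -- starts at m = 2.
          L , s⟶L = nonneg-series a a-nonneg (bounded-drop 2 a-nonneg
            (bounded-telescope (λ j → a (2 ℕ.+ j)) (β K) (β-nonneg 0≤K) (a-step 0≤K bound)))
      in  L , ⟶⇒SumsTo {a} s⟶L
      where
      a : ℕ → ℝ
      a p = if does (prime? p) then term r p else 0#

      a-nonneg : ∀ p → 0# ≤ a p
      -- Passing the decision as an argument lets the `if` reduce in each case.
      a-nonneg p = go (prime? p) where
        go : (d : Dec (Prime p)) → 0# ≤ (if does d then term r p else 0#)
        go (yes pp) = positive p pp where
          positive : ∀ p → Prime p → 0# ≤ term r p
          positive zero    0-prime = ⊥-elim (¬prime[0] 0-prime)
          positive (suc p) _       = term-nonneg r p
        go (no  _) = ≤-refl

      δ : ℝ
      δ = ε + ε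

      0<δ : 0# < δ
      0<δ = subst (λ x → x < δ) (+-identityˡ 0#) (+-mono-<-< 0<ε 0<ε)

      β : ℝ → ℕ → ℝ
      β K j = K * δ ⁻¹ * exp (- (δ * log (fromℕ (suc j))))

      K/δ-nonneg : ∀ {K} → 0# ≤ K → 0# ≤ K * δ ⁻¹
      K/δ-nonneg 0≤K = *-nonneg 0≤K (<⇒≤ (⁻¹-pos 0<δ))

      β-nonneg : ∀ {K} → 0# ≤ K → ∀ j → 0# ≤ β K j
      β-nonneg 0≤K j = *-nonneg (K/δ-nonneg 0≤K) (<⇒≤ (exp-pos _))

      a-step : ∀ {K} → 0# ≤ K → (∀ {r} → 2 ℕ.≤ r → ∀ p →
          (∀ i → ∥ α (suc p) i ∥ ≤ fromℕ (suc p) ^ʳ (quarter - ε)) →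
          let L = log (fromℕ (suc p)) in term r (suc p) ≤ K * (exp (- L) * exp (- (δ * L)))) →
        ∀ j → a (2 ℕ.+ j) ≤ β K j - β K (suc j)
      a-step {K} 0≤K bound j = ≤-trans (go (prime? (2 ℕ.+ j))) (begin
        K * w                   ≡⟨ sym (*-identityˡ _) ⟩
        1# * (K * w)            ≡⟨ cong (λ x → x * (K * w)) (sym (inverse-pos 0<δ)) ⟩
        δ * δ ⁻¹ * (K * w)
          ≡⟨ solve 4 (λ d i k w → d :* i :* (k :* w) := k :* i :* (d :* w)) refl δ (δ ⁻¹) K w ⟩
        K * δ ⁻¹ * (δ * w)
          ≤⟨ *-monoʳ-≤ (K * δ ⁻¹) (K/δ-nonneg 0≤K) (power-telescope (<⇒≤ 0<δ)
               -- `fromℕ (2 ℕ.+ j)` unfolds to `1# + fromℕ (suc j)`, which is the relation required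
               -- between the two logarithms.
               (trans (exp-log (fromℕ-suc-pos (suc j)))
                 (cong (λ x → 1# + x) (sym (exp-log (fromℕ-suc-pos j)))))) ⟩
        K * δ ⁻¹ * (u - v)
          ≡⟨ solve 3 (λ c u v → c :* (u :- v) := c :* u :- c :* v) refl (K * δ ⁻¹) u v ⟩
        β K j - β K (suc j)     ∎)
        where
        L = log (fromℕ (2 ℕ.+ j))
        v = exp (- (δ * L))
        u = exp (- (δ * log (fromℕ (suc j))))
        w = exp (- L) * v

        go : (d : Dec (Prime (2 ℕ.+ j))) → (if does d then term r (2 ℕ.+ j) else 0#) ≤ K * w
        go (yes pp) = bound 2≤r (suc j) (α≤ (2 ℕ.+ j) pp)
        go (no  _)  = *-nonneg 0≤K (*-nonneg (<⇒≤ (exp-pos _)) (<⇒≤ (exp-pos _)))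

theorem1p1 : (em : ExcludedMiddle 0ℓ) (ℛ : CompleteOrderedField) →
    let open Theory em ℛ in
    (k : ℕ) →
    (v : Fin (suc k) → ℂ) (f : Mat (suc (suc k)) → ℂ)
    (A : Vec ℤ (suc k) → ℂ) (α : ℕ → Fin (suc (suc k)) → ℂ) →
    HeckeMaassForm k v f →
    SelfDual k f →
    FourierCoefficients k v f A →
    Normalized k A →
    (∀ p → Prime p → SatakeParameters k A p (α p)) →
    WeakRamanujan k α →
    RudnickSarnak k α
theorem1p1 em ℛ k v f A α _ _ _ _ _ (ε , 0<ε , α≤) r 2≤r =
  Analysis.summable-over-primes em ℛ α 0<ε α≤ 2≤r
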